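{- The elements $\mathbf{P}^{\pi}$, where $\pi$ runs over the set of signed non-decreasing parking functions (nondecreasing parking functions together with a color $0$ or $1$ chosen for each prime factor), form a basis of a cocommutative Hopf subalgebra $\mathbf{NCPQSym}^{(2)}$ of the Hopf algebra $\mathbf{PQSym}^{(2)}$ (with structure maps in the $\mathbf{F}$ basis).
   Context: A parking function of length $n$ is a word $\mathbf{a}=a_1\cdots a_n$ on $\{1,\ldots,n\}$ whose nondecreasing rearrangement $a_1'\cdots a_n'$ satisfies $a_i'\le i$. It is prime if the only $b\in\{1,\dots,n\}$ with $|\{i:a_i\le b\}|=b$ is $b=n$. The shifted concatenation of words is $v\bullet v'=v\cdot v'[k]$, $k=|v|$, where $v'[k]$ is $v'$ with $k$ added to each letter. Every nondecreasing parking function factors uniquely as a maximal shifted concatenation of prime nondecreasing parking functions; choosing a color in $\{0,1\}$ for each factor and giving this color to all the letters of the factor, one obtains the colored words $\pi$ (there are $\binom{2n}{n}$ of them of length $n$, identified with type $B$ non-crossing partitions). A $2$-colored parking function is a pair $(\mathbf{a},u)$ of a parking function and a word $u$ of the same length on $\{0,1\}$. The $\mathbf{F}_{(\mathbf{a},u)}$ form a basis of a graded Hopf algebra with $$\mathbf{F}_{(\mathbf{a}',u')}\mathbf{F}_{(\mathbf{a}'',u'')}=\sum_{(\mathbf{a},u)\in(\mathbf{a}',u')\Cup(\mathbf{a}'',u'')}\mathbf{F}_{(\mathbf{a},u)},\qquad \Delta\mathbf{F}_{(\mathbf{a},u)}=\sum_{p'p''=\mathbf{a},\ u'u''=u,\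 |p'|=|u'|}\mathbf{F}_{(\mathrm{Park}(p'),u')}\otimes\mathbf{F}_{(\mathrm{Park}(p''),u'')}.$$ Here $(\mathbf{a}',u')\Cup(\mathbf{a}'',u'')$ is the shifted shuffle: the shuffle of the words of biletters $(\mathbf{a}',u')$ and $(\mathbf{a}''[k],u'')$, $k=|\mathbf{a}'|$ (colors follow their letters). $\mathrm{Park}$ is the parkization: for a word $w$ of length $n$ of positive integers, let $d(w)=\min\{i:\#\{j:w_j\le i\}<i\}$; if $d(w)=n+1$ then $\mathrm{Park}(w)=w$; otherwise $\mathrm{Park}(w)=\mathrm{Park}(w')$ where $w'$ is obtained by decreasing by $1$ all letters of $w$ greater than $d(w)$. For $\pi$ a colored word obtained from a nondecreasing parking function by choosing a color in $\{0,1\}$ for each factor of its maximal factorization into prime nondecreasing parking functions and giving this color to all the letters of the factor, $$\mathbf{P}^{\pi}=\sum_{(\mathbf{a},u)^{\uparrow}=\pi}\mathbf{F}_{(\mathbf{a},u)},$$ where $w^\uparrow$ denotes the nondecreasing rearrangement of the letters of the colored word $w$ (each letter keeping its color); i.e. the sum is over all distinct rearrangements of the colored word $\pi$. -}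

module Defs where

open import Algebra.Bundles using (CommutativeRing)
open import Data.Bool.Base using (true; false; if_then_else_)
open import Data.Fin.Base as Fin using (Fin; toℕ)
open import Data.Fin.Instances public
open import Data.Irrelevant as Irrelevant using (Irrelevant; [_])
open import Data.List.Base using
  (List; []; _∷_; _++_; map; concatMap; foldr; filter; length; lookup; zip; take;
   drop; upTo; deduplicate)
open import Data.List.Instances public
  using (List-≡-isDecEquivalence)
open import Data.List.Properties using
  (++-identityʳ; length-map; length-++; map-++; map-id; map-∘; filter-++; filter-all; filter-accept;
   filter-reject; length-filter)
open import Data.List.Relation.Binary.Permutation.Propositional using
  (_↭_; ↭-refl; ↭-reflexive; ↭-sym; ↭-trans; prep; swap)
open import Data.List.Relation.Binary.Permutation.Propositional.Properties using
  (All-resp-↭; ↭-length; filter-↭; shift)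
  renaming (map⁺ to ↭-map⁺)
open import Data.List.Relation.Unary.All as All using (All; []; _∷_)
import Data.List.Relation.Unary.All.Properties as All
open import Data.List.Relation.Unary.Linked as Linked using (_∷_)
open import Data.Nat.Base using
  (ℕ; zero; suc; pred; _+_; _≤_; _<_; _≤ᵇ_; _<ᵇ_; _≡ᵇ_; z≤n; s≤s; s≤s⁻¹)
open import Data.Nat.Instances public
open import Data.Nat.ListAction using (sum)
open import Data.Nat.Properties as ℕ using
  (_≤?_; ≤-refl; ≤-trans; ≤-totalOrder; ≤-decTotalOrder)
open import Data.Product.Base using (∃; _×_; _,_; proj₁; proj₂; map₁; uncurry)
open import Data.Product.Instances public
open import Data.Refinement as Refinement using (Refinement; Refinement-syntax; value; _,_)
open import Data.Sum.Base using (_⊎_; inj₁; inj₂)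
open import Function.Base using (_∘_)
open import Level using (Level; _⊔_)
open import Relation.Binary.PropositionalEquality using
  (_≡_; refl; sym; trans; cong; cong₂; subst)
open import Relation.Binary.PropositionalEquality.Properties using (isDecEquivalence)
open import Relation.Binary.Structures using (IsDecEquivalence)
open import Relation.Binary.TypeClasses using (_≟_)
open import Relation.Nullary using (does; contradiction; Reflects; ofʸ; ofⁿ)
open import Relation.Nullary.Reflects using (fromEquivalence)
open import Relation.Unary using (Pred; _∈_)

import Data.List.Sort ≤-decTotalOrder as Sort
open import Data.List.Relation.Unary.Sorted.TotalOrder ≤-totalOrder using (Sorted)

private
  variable
    a b p : Level
    A : Set a
    B : Set b

#≤ : ℕ → List ℕ → ℕ
#≤ b w = length (filter (_≤? b) w)

IsParking : List ℕ → Set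
IsParking w =
  All (λ x → 1 ≤ x × x ≤ length w) w ×
  (∀ i → lookup (Sort.sort w) i ≤ suc (toℕ i))

-- The empty word is not prime: for n = 0 the value b = n is not in {1,…,n}.
IsPrime : List ℕ → Set
IsPrime w = 1 ≤ length w ×
  (∀ b → 1 ≤ b → b ≤ length w → #≤ b w ≡ b → b ≡ length w)

NDPF : Set
NDPF = [ w ∈ List ℕ ∣ IsParking w × Sorted w ]

PrimeNDPF : Set
PrimeNDPF = [ w ∈ List ℕ ∣ IsParking w × Sorted w × IsPrime w ]

infixr 5 _•_
_•_ : List ℕ → List ℕ → List ℕ
v • v′ = v ++ map (length v +_) v′

-- The search covers 1,…,n; its default n + 1 always satisfies the condition.
d : List ℕ → ℕ
d w = search (length w) 1
  module d where
  search : ℕ → ℕ → ℕ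
  search zero    i = i
  search (suc m) i = if #≤ i w <ᵇ i then i else search m (suc i)

lower : ℕ → List ℕ → List ℕ
lower e = map (λ x → if e <ᵇ x then pred x else x)

parkSteps : ℕ → List ℕ → List ℕ
parkSteps zero    w = w
parkSteps (suc m) w =
  if d w ≡ᵇ suc (length w) then w else parkSteps m (lower (d w) w)

-- Each step taken strictly decreases the sum of the letters, so the sum is a
-- sufficient bound on the number of steps (see Park-isParking).
Park : List ℕ → List ℕ
Park w = parkSteps (sum w) w

Color : Set
Color = Fin 2

CWord : Set
CWord = List (ℕ × Color)

letters : CWord → List ℕ
letters = map proj₁

colors : CWord → List Color
colors = map proj₂

shiftBy : ℕ → CWord → CWord
shiftBy k = map (map₁ (k +_))

infixr 5 _•ᶜ_
_•ᶜ_ : CWord → CWord → CWord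
v •ᶜ v′ = v ++ shiftBy (length v) v′

parkᶜ : CWord → CWord
parkᶜ w = zip (Park (letters w)) (colors w)

-- All interleavings, one for each choice of the positions of the first word.
shuffles : List A → List A → List (List A)
shuffles []       ys       = ys ∷ []
shuffles (x ∷ xs) []       = (x ∷ xs) ∷ []
shuffles (x ∷ xs) (y ∷ ys) =
  map (x ∷_) (shuffles xs (y ∷ ys)) ++ map (y ∷_) (shuffles (x ∷ xs) ys)

shiftedShuffles : CWord → CWord → List CWord
shiftedShuffles v v′ = shuffles v (shiftBy (length v) v′)

insertions : A → List A → List (List A)
insertions x []       = (x ∷ []) ∷ []
insertions x (y ∷ ys) = (x ∷ y ∷ ys) ∷ map (y ∷_) (insertions x ys)

permutations : List A → List (List A)
permutations []       = [] ∷ []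
permutations (x ∷ xs) = concatMap (insertions x) (permutations xs)

rearrangements : CWord → List CWord
rearrangements w = deduplicate _≟_ (permutations w)

#≤-accept : ∀ b x w → x ≤ b → #≤ b (x ∷ w) ≡ suc (#≤ b w)
#≤-accept b x w x≤b = cong length (filter-accept (_≤? b) x≤b)

#≤-↭ : ∀ b {v w} → v ↭ w → #≤ b v ≡ #≤ b w
#≤-↭ b v↭w = ↭-length (filter-↭ (_≤? b) v↭w)

#≤-all : ∀ b {w} → All (_≤ b) w → #≤ b w ≡ length w
#≤-all b all = cong length (filter-all (_≤? b) all)

#≤-++ : ∀ b v w → #≤ b (v ++ w) ≡ #≤ b v + #≤ b w
#≤-++ b v w = trans (cong length (filter-++ (_≤? b) v w)) (length-++ (filter (_≤? b) v))

#≤-shift : ∀ k b w → #≤ (k + b) (map (k +_) w) ≡ #≤ b w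
#≤-shift k b []      = refl
#≤-shift k b (x ∷ w) with x ≤ᵇ b | ℕ.≤ᵇ-reflects-≤ x b
... | true  | ofʸ x≤b = trans (#≤-accept (k + b) (k + x) (map (k +_) w) (ℕ.+-monoʳ-≤ k x≤b))
                      (cong suc (#≤-shift k b w))
... | false | ofⁿ x≰b = trans (cong length (filter-reject (_≤? (k + b)) (x≰b ∘ ℕ.+-cancelˡ-≤ k x b)))
                      (#≤-shift k b w)

#≤-mono : ∀ {b b′} w → b ≤ b′ → #≤ b w ≤ #≤ b′ w
#≤-mono [] b≤b′ = z≤n
#≤-mono {b} {b′} (x ∷ w) b≤b′ with x ≤ᵇ b | x ≤ᵇ b′ | ℕ.≤ᵇ-reflects-≤ x b | ℕ.≤ᵇ-reflects-≤ x b′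
... | true  | true  | _        | _        = s≤s (#≤-mono w b≤b′)
... | true  | false | ofʸ x≤b | ofⁿ x≰b′ = contradiction (≤-trans x≤b b≤b′) x≰b′
... | false | true  | _        | _        = ℕ.m≤n⇒m≤1+n (#≤-mono w b≤b′)
... | false | false | _        | _        = #≤-mono w b≤b′

#≤-length : ∀ b w → length w ≤ #≤ b w → All (_≤ b) w
#≤-length b [] _ = []
#≤-length b (x ∷ w) h with x ≤ᵇ b | ℕ.≤ᵇ-reflects-≤ x b
... | true  | ofʸ x≤b = x≤b ∷ #≤-length b w (s≤s⁻¹ h)
... | false | _       = contradiction (≤-trans h (length-filter (_≤? b) w)) ℕ.1+n≰n

lookup≤⇒#≤ : ∀ k s → (∀ i → lookup s i ≤ k + suc (toℕ i)) →
     ∀ j → j ≤ length s → j ≤ #≤ (k + j) s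
lookup≤⇒#≤ k s       h zero    _       = z≤n
lookup≤⇒#≤ k (x ∷ s) h (suc j) (s≤s l) =
  subst (suc j ≤_)
    (sym (#≤-accept (k + suc j) x s (≤-trans (h Fin.zero) (ℕ.+-monoʳ-≤ k (s≤s z≤n)))))
    (s≤s (subst (λ m → j ≤ #≤ m s) (sym (ℕ.+-suc k j))
      (lookup≤⇒#≤ (suc k) s (λ i → subst (lookup s i ≤_) (ℕ.+-suc k _) (h (Fin.suc i))) j l)))

sorted-head : ∀ {x s} m → Sorted (x ∷ s) → 1 ≤ #≤ m (x ∷ s) → x ≤ m
sorted-head {x} {s} m srt h with x ≤ᵇ m | ℕ.≤ᵇ-reflects-≤ x m
... | true | ofʸ x≤m = x≤m
sorted-head {x} {[]} m srt () | false | ofⁿ x≰m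
sorted-head {x} {y ∷ s} m (x≤y ∷ srt) h | false | ofⁿ x≰m = ≤-trans x≤y (sorted-head m srt h)

#≤⇒lookup≤ : ∀ k s → Sorted s → (∀ j → j ≤ length s → j ≤ #≤ (k + j) s) →
       ∀ i → lookup s i ≤ k + suc (toℕ i)
#≤⇒lookup≤ k (x ∷ s) srt h Fin.zero    = sorted-head (k + 1) srt (h 1 (s≤s z≤n))
#≤⇒lookup≤ k (x ∷ s) srt h (Fin.suc i) =
  subst (lookup s i ≤_) (sym (ℕ.+-suc k _)) (#≤⇒lookup≤ (suc k) s (Linked.tail srt) h′ i)
  where
  x≤ : x ≤ k + 1
  x≤ = sorted-head (k + 1) srt (h 1 (s≤s z≤n))
  h′ : ∀ j → j ≤ length s → j ≤ #≤ (suc k + j) s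
  h′ j l = subst (λ m → j ≤ #≤ m s) (ℕ.+-suc k j)
    (s≤s⁻¹ (subst (suc j ≤_)
      (#≤-accept (k + suc j) x s (≤-trans x≤ (ℕ.+-monoʳ-≤ k (s≤s z≤n))))
      (h (suc j) (s≤s l))))

IsParking⇒positive : ∀ {w} → IsParking w → All (1 ≤_) w
IsParking⇒positive = All.map proj₁ ∘ proj₁

IsParking⇒#≤ : ∀ {w} → IsParking w → ∀ b → b ≤ length w → b ≤ #≤ b w
IsParking⇒#≤ {w} (_ , h) b l =
  subst (b ≤_) (#≤-↭ b (Sort.sort-↭ w))
    (lookup≤⇒#≤ 0 (Sort.sort w) h b (subst (b ≤_) (sym (↭-length (Sort.sort-↭ w))) l))

#≤⇒IsParking : ∀ {w} → All (1 ≤_) w → (∀ b → b ≤ length w → b ≤ #≤ b w) → IsParking w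
#≤⇒IsParking {w} pos h =
  All.zip (pos , #≤-length _ w (h (length w) ≤-refl)) ,
  #≤⇒lookup≤ 0 (Sort.sort w) (Sort.sort-↗ w)
    (λ j l → subst (j ≤_) (sym (#≤-↭ j (Sort.sort-↭ w)))
               (h j (subst (j ≤_) (↭-length (Sort.sort-↭ w)) l)))

IsParking-↭ : ∀ {v w} → v ↭ w → IsParking v → IsParking w
IsParking-↭ v↭w pf = #≤⇒IsParking (All-resp-↭ v↭w (IsParking⇒positive pf))
  (λ b l → subst (b ≤_) (#≤-↭ b v↭w)
             (IsParking⇒#≤ pf b (subst (b ≤_) (sym (↭-length v↭w)) l)))

IsParking-• : ∀ {v w} → IsParking v → IsParking w → IsParking (v • w)
IsParking-• {v} {w} pv pw = #≤⇒IsParking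
  (All.++⁺ (IsParking⇒positive pv)
           (All.map⁺ (All.map (λ l → ≤-trans l (ℕ.m≤n+m _ (length v))) (IsParking⇒positive pw))))
  count
  where
  k = length v
  count : ∀ b → b ≤ length (v • w) → b ≤ #≤ b (v • w)
  count b l with ℕ.≤-total b k
  ... | inj₁ b≤k = subst (b ≤_) (sym (#≤-++ b v (map (k +_) w)))
                     (≤-trans (IsParking⇒#≤ pv b b≤k) (ℕ.m≤m+n _ _))
  ... | inj₂ k≤b with ℕ.m≤n⇒∃[o]m+o≡n k≤b
  ... | m , refl = subst (k + m ≤_) (sym (#≤-++ (k + m) v (map (k +_) w)))
    (ℕ.+-mono-≤
      (≤-trans (IsParking⇒#≤ pv k ≤-refl) (#≤-mono v (ℕ.m≤m+n k m)))
      (subst (m ≤_) (sym (#≤-shift k m w)) (IsParking⇒#≤ pw m m≤w)))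
    where
    m≤w : m ≤ length w
    m≤w = ℕ.+-cancelˡ-≤ k m (length w)
      (subst (k + m ≤_) (trans (length-++ v) (cong (k +_) (length-map (k +_) w))) l)

letters-•ᶜ : ∀ v w → letters (v •ᶜ w) ≡ letters v • letters w
letters-•ᶜ v w = trans (map-++ proj₁ v (shiftBy (length v) w))
  (cong (letters v ++_)
    (trans (sym (map-∘ w))
      (trans (map-∘ w) (cong (λ k → map (k +_) (letters w)) (sym (length-map proj₁ v))))))

shuffles-↭ : ∀ (xs ys : List A) → All (_↭ (xs ++ ys)) (shuffles xs ys)
shuffles-↭ []       ys       = ↭-refl ∷ []
shuffles-↭ (x ∷ xs) []       =
  ↭-reflexive (sym (++-identityʳ (x ∷ xs))) ∷ []
shuffles-↭ (x ∷ xs) (y ∷ ys) = All.++⁺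
  (All.map⁺ (All.map (prep x) (shuffles-↭ xs (y ∷ ys))))
  (All.map⁺ (All.map (λ p → ↭-trans (prep y p) (↭-sym (shift y (x ∷ xs) ys)))
                     (shuffles-↭ (x ∷ xs) ys)))

insertions-↭ : ∀ (x : A) xs → All (_↭ (x ∷ xs)) (insertions x xs)
insertions-↭ x []       = ↭-refl ∷ []
insertions-↭ x (y ∷ ys) = ↭-refl ∷
  All.map⁺ (All.map (λ p → ↭-trans (prep y p) (swap y x ↭-refl)) (insertions-↭ x ys))

permutations-↭ : ∀ (xs : List A) → All (_↭ xs) (permutations xs)
permutations-↭ []       = ↭-refl ∷ []
permutations-↭ (x ∷ xs) = All.concat⁺ (All.map⁺
  (All.map (λ p → All.map (λ q → ↭-trans q (prep x p)) (insertions-↭ x _))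
           (permutations-↭ xs)))

shiftedShuffles-isParking : ∀ {v w} → IsParking (letters v) → IsParking (letters w) →
                            All (IsParking ∘ letters) (shiftedShuffles v w)
shiftedShuffles-isParking {v} {w} pv pw =
  All.map (λ s↭ → IsParking-↭ (↭-sym (↭-map⁺ proj₁ s↭))
                    (subst IsParking (sym (letters-•ᶜ v w)) (IsParking-• pv pw)))
          (shuffles-↭ v (shiftBy (length v) w))

rearrangements-isParking : ∀ {w} → IsParking (letters w) →
                           All (IsParking ∘ letters) (rearrangements w)
rearrangements-isParking {w} pw = All.deduplicate⁺ _≟_
  (All.map (λ s↭ → IsParking-↭ (↭-sym (↭-map⁺ proj₁ s↭)) pw) (permutations-↭ w))

search-spec : ∀ w m i → (d.search w m i ≡ m + i × (∀ j → i ≤ j → j < m + i → j ≤ #≤ j w)) ⊎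
              (i ≤ d.search w m i × #≤ (d.search w m i) w < d.search w m i × d.search w m i < m + i)
search-spec w zero    i = inj₁ (refl , λ j i≤j j<i → contradiction (≤-trans j<i i≤j) ℕ.1+n≰n)
search-spec w (suc m) i with #≤ i w <ᵇ i | ℕ.<ᵇ-reflects-< (#≤ i w) i
... | true  | ofʸ c = inj₂ (≤-refl , c , s≤s (ℕ.m≤n+m i m))
... | false | ofⁿ ¬c with d.search w m (suc i) | search-spec w m (suc i)
...   | e | inj₁ (eq , h) = inj₁ (trans eq (ℕ.+-suc m i) , h′)
  where
  h′ : ∀ j → i ≤ j → j < suc (m + i) → j ≤ #≤ j w
  h′ j i≤j j< with ℕ.m≤n⇒m<n∨m≡n i≤j
  ... | inj₁ i<j  = h j i<j (subst (j <_) (sym (ℕ.+-suc m i)) j<)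
  ... | inj₂ refl = ℕ.≮⇒≥ ¬c
...   | e | inj₂ (l , c , u) = inj₂ (ℕ.<⇒≤ l , c , subst (e <_) (ℕ.+-suc m i) u)

lower-sum : ∀ e w → #≤ e w < length w → sum (lower e w) < sum w
lower-≤   : ∀ e w → sum (lower e w) ≤ sum w
lower-sum e (x ∷ w) h with x ≤ᵇ e | e <ᵇ x | ℕ.≤ᵇ-reflects-≤ x e | ℕ.<ᵇ-reflects-< e x
... | true  | true  | ofʸ x≤e | ofʸ e<x = contradiction (≤-trans e<x x≤e) ℕ.1+n≰n
... | true  | false | _       | _       = ℕ.+-monoʳ-< x (lower-sum e w (s≤s⁻¹ h))
lower-sum e (suc x ∷ w) h | false | true | _ | _ = s≤s (ℕ.+-monoʳ-≤ x (lower-≤ e w))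
lower-sum e (x ∷ w) h | false | false | ofⁿ x≰e | ofⁿ e≮x = contradiction (ℕ.≰⇒> x≰e) e≮x
lower-≤ e []      = z≤n
lower-≤ e (x ∷ w) with e <ᵇ x | ℕ.<ᵇ-reflects-< e x
... | true  | _ = ℕ.+-mono-≤ (ℕ.pred[n]≤n {x}) (lower-≤ e w)
... | false | _ = ℕ.+-monoʳ-≤ x (lower-≤ e w)

lower-positive : ∀ e {w} → 1 ≤ e → All (1 ≤_) w → All (1 ≤_) (lower e w)
lower-positive e 1≤e []           = []
lower-positive e {x ∷ w} 1≤e (p ∷ ps) with e <ᵇ x | ℕ.<ᵇ-reflects-< e x
... | true  | ofʸ e<x = ℕ.<⇒≤pred (≤-trans (s≤s 1≤e) e<x) ∷ lower-positive e 1≤e ps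
... | false | _       = p ∷ lower-positive e 1≤e ps

≡ᵇ-reflects : ∀ m n → Reflects (m ≡ n) (m ≡ᵇ n)
≡ᵇ-reflects m n = fromEquivalence (ℕ.≡ᵇ⇒≡ m n) (ℕ.≡⇒≡ᵇ m n)

parkSteps-isParking : ∀ m w → sum w ≤ m → All (1 ≤_) w → IsParking (parkSteps m w)
parkSteps-isParking zero    []          s≤m pos = #≤⇒IsParking [] (λ b l → l)
parkSteps-isParking zero    (x ∷ w)     s≤m (p ∷ _) =
  contradiction (≤-trans p (≤-trans (ℕ.m≤m+n x (sum w)) s≤m)) ℕ.1+n≰n
parkSteps-isParking (suc m) w s≤m pos with d w ≡ᵇ suc (length w) | ≡ᵇ-reflects (d w) (suc (length w)) | search-spec w (length w) 1
... | true | _ | inj₁ (_ , h) = #≤⇒IsParking pos count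
  where
  count : ∀ b → b ≤ length w → b ≤ #≤ b w
  count zero    _ = z≤n
  count (suc b) l = h (suc b) (s≤s z≤n) (subst (suc b <_) (ℕ.+-comm 1 _) (s≤s l))
... | true | ofʸ eq | inj₂ (_ , _ , u) =
  contradiction (trans eq (ℕ.+-comm 1 _)) (ℕ.<⇒≢ u)
... | false | ofⁿ ≢ | inj₁ (eq , _) = contradiction (trans eq (ℕ.+-comm _ 1)) ≢
... | false | _ | inj₂ (l , c , u) = parkSteps-isParking m (lower (d w) w)
  (s≤s⁻¹ (≤-trans (lower-sum (d w) w
      (≤-trans c (s≤s⁻¹ (subst (d w <_) (ℕ.+-comm (length w) 1) u)))) s≤m))
  (lower-positive (d w) l pos)

parkSteps-length : ∀ m w → length (parkSteps m w) ≡ length w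
parkSteps-length zero    w = refl
parkSteps-length (suc m) w with d w ≡ᵇ suc (length w)
... | true  = refl
... | false = trans (parkSteps-length m (lower (d w) w)) (length-map _ w)

letters-zip : ∀ v (u : List Color) → length v ≡ length u → letters (zip v u) ≡ v
letters-zip []      []      _ = refl
letters-zip (x ∷ v) (c ∷ u) h = cong (x ∷_) (letters-zip v u (ℕ.suc-injective h))

Park-isParking : ∀ {w} → All (1 ≤_) w → IsParking (Park w)
Park-isParking {w} = parkSteps-isParking (sum w) w ≤-refl

letters-parkᶜ : ∀ w → letters (parkᶜ w) ≡ Park (letters w)
letters-parkᶜ w = letters-zip (Park (letters w)) (colors w)
  (trans (parkSteps-length (sum (letters w)) (letters w))
         (trans (length-map proj₁ w) (sym (length-map proj₂ w))))

parkᶜ-isParking : ∀ {w} → All (1 ≤_) (letters w) → IsParking (letters (parkᶜ w))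
parkᶜ-isParking {w} pos = subst IsParking (sym (letters-parkᶜ w)) (Park-isParking pos)

ColoredPF : Set
ColoredPF = [ w ∈ CWord ∣ IsParking (letters w) ]

instance
  Refinement-≡-isDecEquivalence :
    {P : A → Set p} ⦃ _ : IsDecEquivalence {A = A} _≡_ ⦄ →
    IsDecEquivalence {A = Refinement A P} _≡_
  Refinement-≡-isDecEquivalence = isDecEquivalence (Refinement._≟_ _≟_)

refineAll : {P : A → Set p} (xs : List A) → Irrelevant (All P xs) → List (Refinement A P)
refineAll []       _ = []
refineAll (x ∷ xs) h = (x , Irrelevant.map All.head h) ∷ refineAll xs (Irrelevant.map All.tail h)

∅ : ColoredPF
∅ = [] , [ #≤⇒IsParking [] (λ b l → l) ]

infixr 5 _⋓_
_⋓_ : ColoredPF → ColoredPF → List ColoredPF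
(v , [ pv ]) ⋓ (w , [ pw ]) =
  refineAll (shiftedShuffles v w) [ shiftedShuffles-isParking pv pw ]

-- The parkized pairs (Park p′ , Park p″) for w = p′p″ with |p′| = 0,…,|w|.
cuts : ColoredPF → List (ColoredPF × ColoredPF)
cuts (w , [ pw ]) = map (λ i →
    (parkᶜ (take i w) , [ parkᶜ-isParking (All.map⁺ (All.take⁺ i (positive pw))) ]) ,
    (parkᶜ (drop i w) , [ parkᶜ-isParking (All.map⁺ (All.drop⁺ i (positive pw))) ]))
  (upTo (suc (length w)))
  where
  positive : IsParking (letters w) → All ((1 ≤_) ∘ proj₁) w
  positive pf = All.map⁻ (IsParking⇒positive pf)

coloredConcat : List (PrimeNDPF × Color) → CWord
coloredConcat = foldr (λ (q , c) w → map (_, c) (value q) •ᶜ w) []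

-- A nondecreasing parking function together with its factorization into
-- primes, each factor carrying a colour.
SignedNDPF : Set
SignedNDPF =
  [ (w , fs) ∈ NDPF × List (PrimeNDPF × Color) ∣
    foldr (λ (q , _) v → value q • v) [] fs ≡ value w ]

letters-coloredConcat : ∀ fs →
  letters (coloredConcat fs) ≡ foldr (λ (q , _) v → value q • v) [] fs
letters-coloredConcat []             = refl
letters-coloredConcat ((q , c) ∷ fs) =
  trans (letters-•ᶜ (map (_, c) (value q)) (coloredConcat fs))
    (cong₂ _•_ (trans (sym (map-∘ (value q))) (map-id (value q))) (letters-coloredConcat fs))

coloredPF : SignedNDPF → ColoredPF
coloredPF (((w , [ pw ]) , fs) , [ eq ]) = coloredConcat fs ,
  [ subst IsParking (sym (trans (letters-coloredConcat fs) eq)) (proj₁ pw) ]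

-- The distinct rearrangements of the coloured word of π, i.e. the (a , u) with
-- (a , u)↑ = π (no ambiguity: equal letters of π have the same colour).
orbit : SignedNDPF → List ColoredPF
orbit π = refineAll (rearrangements (value (coloredPF π)))
  (Irrelevant.map rearrangements-isParking (Refinement.proof (coloredPF π)))

module FreeModule {c ℓ} (K : CommutativeRing c ℓ) where

  open CommutativeRing K
    using (Carrier; 0#; 1#; _≈_) renaming (_+_ to _+ᴷ_; _*_ to _*ᴷ_)

  -- Formal linear combinations of elements of B, a basis element being allowed
  -- to occur repeatedly; two of them are identified when all coefficients agree.
  Lin : Set b → Set (b ⊔ c)
  Lin B = List (Carrier × B)

  module _ {B : Set b} ⦃ _ : IsDecEquivalence {A = B} _≡_ ⦄ where

    coeff : Lin B → B → Carrier
    coeff []            b = 0#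
    coeff ((k , b′) ∷ x) b = (if does (b′ ≟ b) then k else 0#) +ᴷ coeff x b

    infix 4 _≋_
    _≋_ : Lin B → Lin B → Set (b ⊔ ℓ)
    x ≋ y = ∀ b → coeff x b ≈ coeff y b

  0ᴸ : Lin B
  0ᴸ = []

  infixl 6 _+ᴸ_
  _+ᴸ_ : Lin B → Lin B → Lin B
  _+ᴸ_ = _++_

  infixr 7 _·_
  _·_ : Carrier → Lin B → Lin B
  k · x = map (map₁ (k *ᴷ_)) x

  basis : B → Lin B
  basis b = (1# , b) ∷ []

  ∑ : List B → Lin B
  ∑ = map (1# ,_)

  linear : (A → Lin B) → Lin A → Lin B
  linear f = concatMap (λ (k , a) → k · f a)

  bilinear : {C : Set p} → (A → B → Lin C) → Lin A → Lin B → Lin C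
  bilinear f x y = linear (λ a → linear (f a) y) x

  -- The tensor product of the free modules on A and on B is the free module
  -- on A × B.
  infixr 7 _⊗_
  _⊗_ : Lin A → Lin B → Lin (A × B)
  _⊗_ = bilinear (λ a b → basis (a , b))

  twist : Lin (A × B) → Lin (B × A)
  twist = linear (λ (a , b) → basis (b , a))

  module _ {I : Set a} {B : Set b}
    ⦃ _ : IsDecEquivalence {A = I} _≡_ ⦄ ⦃ _ : IsDecEquivalence {A = B} _≡_ ⦄ where

    Span : (I → Lin B) → Pred (Lin B) (a ⊔ b ⊔ c ⊔ ℓ)
    Span v x = ∃ λ (k : Lin I) → x ≋ linear v k

    LinearlyIndependent : (I → Lin B) → Set (a ⊔ b ⊔ c ⊔ ℓ)
    LinearlyIndependent v = ∀ (k : Lin I) → linear v k ≋ 0ᴸ → k ≋ 0ᴸ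

    record IsBasisOf (v : I → Lin B) {p} (V : Pred (Lin B) p) : Set (a ⊔ b ⊔ c ⊔ ℓ ⊔ p) where
      field
        member      : ∀ i → v i ∈ V
        independent : LinearlyIndependent v
        spanning    : ∀ x → x ∈ V → x ∈ Span v

  -- The structure maps of a bialgebra with underlying module Lin B, given by
  -- their values on the basis B.
  record StructureMaps (B : Set b) : Set (b ⊔ c) where
    field
      product   : B → B → Lin B
      unit      : Lin B
      coproduct : B → Lin (B × B)
      counit    : B → Carrier

    infixl 7 _∙_
    _∙_ : Lin B → Lin B → Lin B
    _∙_ = bilinear product

    Δ : Lin B → Lin (B × B)
    Δ = linear coproduct

  module _ {B : Set b} ⦃ _ : IsDecEquivalence {A = B} _≡_ ⦄ (H : StructureMaps B) where

    open StructureMaps H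

    -- S is given on the basis; the two equations say that its linear extension
    -- is the two-sided convolution inverse of the identity.
    record IsAntipode (S : B → Lin B) : Set (b ⊔ c ⊔ ℓ) where
      field
        inverseˡ : ∀ b → linear (λ (b₁ , b₂) → S b₁ ∙ basis b₂) (coproduct b) ≋ counit b · unit
        inverseʳ : ∀ b → linear (λ (b₁ , b₂) → basis b₁ ∙ S b₂) (coproduct b) ≋ counit b · unit

    -- V ⊗ V as a submodule of Lin (B × B).
    TensorSquare : Pred (Lin B) p → Pred (Lin (B × B)) (b ⊔ c ⊔ ℓ ⊔ p)
    TensorSquare V z = ∃ λ (ts : List (Lin B × Lin B)) →
      All (λ (x , y) → x ∈ V × y ∈ V) ts × z ≋ concatMap (uncurry _⊗_) ts

    record IsHopfSubalgebra (V : Pred (Lin B) p) : Set (b ⊔ c ⊔ ℓ ⊔ p) where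
      field
        ≋-closed  : ∀ {x y} → x ≋ y → x ∈ V → y ∈ V
        0-closed  : 0ᴸ ∈ V
        +-closed  : ∀ {x y} → x ∈ V → y ∈ V → x +ᴸ y ∈ V
        ·-closed  : ∀ k {x} → x ∈ V → k · x ∈ V
        1-closed  : unit ∈ V
        ∙-closed  : ∀ {x y} → x ∈ V → y ∈ V → x ∙ y ∈ V
        Δ-closed  : ∀ {x} → x ∈ V → Δ x ∈ TensorSquare V
        -- Antipodes being unique, this speaks of the antipode of H.
        S-closed  : ∀ {S} → IsAntipode S → ∀ {x} → x ∈ V → linear S x ∈ V

    IsCocommutativeOn : Pred (Lin B) p → Set (b ⊔ c ⊔ ℓ ⊔ p)
    IsCocommutativeOn V = ∀ {x} → x ∈ V → twist (Δ x) ≋ Δ x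

module _ {c ℓ} (K : CommutativeRing c ℓ) where

  open CommutativeRing K using (Carrier; 0#; 1#)
  open FreeModule K

  -- F_(a,u) is `basis (a , u)`.  Unit and counit are those of the grading by
  -- length, whose degree 0 part is spanned by F of the empty word.
  PQSym² : StructureMaps ColoredPF
  PQSym² = record
    { product   = λ v w → ∑ (v ⋓ w)
    ; unit      = basis ∅
    ; coproduct = λ w → ∑ (cuts w)
    ; counit    = λ w → if does (w ≟ ∅) then 1# else 0#
    }

  P : SignedNDPF → Lin ColoredPF
  P π = ∑ (orbit π)

  NCPQSym² : Pred (Lin ColoredPF) (c ⊔ ℓ)
  NCPQSym² = Span P

-- Two lists without repetitions and with the same elements agree up to order, and
-- ∑ ignores the order; so every identity between sums over orbits reduces to a
-- description of the words that occur.  A word in a shifted shuffle determines its two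
-- parts through the size of the letters, whence P π ∙ P σ = P (π ⊕ σ).  The pairs (u , v)
-- with u v a rearrangement of π form a list symmetric under u ↔ v (cocommutativity),
-- and grouping them by the multisets of letters of u and v writes Δ (P π) as a sum
-- of tensors P α ⊗ P β.  For this, parkization must turn each part into a word of
-- the same kind: it acts on letters by a strictly increasing relabelling that depends
-- only on the multiset of letters, and the values b at which the colour may change
-- (GoodCut) are inherited by subwords and carried along by the relabelling.
-- Closure under the antipode follows from the coproduct formula by induction on the
-- degree.

module Submission where

open import Defs
open import Algebra.Bundles using (CommutativeRing)
import Algebra.Properties.CommutativeSemigroup as CommutativeSemigroupProperties
import Algebra.Properties.Ring as RingProperties
open import Data.Bool.Base using (true; false; if_then_else_)
import Data.Fin.Properties as Fin
open import Data.Irrelevant using (Irrelevant; [_])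
open import Data.List.Base using
  (List; []; _∷_; _++_; map; concatMap; foldr; filter; length; lookup; zip; take; drop; upTo;
   deduplicate; cartesianProduct)
import Data.List.Membership.DecPropositional as DecMembership
open import Data.List.Membership.Propositional using (_∈_; find; lose)
open import Data.List.Membership.Propositional.Properties using
  (∈-deduplicate⁺; ∈-deduplicate⁻; ∈-++⁺ˡ; ∈-++⁺ʳ; ∈-++⁻; ∈-map⁺; ∈-map⁻; ∈-concatMap⁺; ∈-concatMap⁻;
   ∈-∃++; ∈-upTo⁺; ∈-upTo⁻; ∈-cartesianProduct⁺; ∈-cartesianProduct⁻; ∈-filter⁺; ∈-filter⁻)
open import Data.List.Membership.Propositional.Properties.WithK using (unique∧set⇒bag)
import Data.List.Properties as List
open import Data.List.Properties using
  (map-id; map-id-local; map-∘; map-cong; map-cong-local; map-++; map-injective; map-concatMap;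
   length-map; length-++; length-take; ∷-injectiveˡ; ∷-injectiveʳ; ++-assoc; take++drop≡id;
   filter-++; filter-all; filter-none; concatMap-++; concatMap-map; concatMap-cong)
open import Data.List.Relation.Binary.BagAndSetEquality using (∼bag⇒↭)
open import Data.List.Relation.Binary.Disjoint.Propositional using (Disjoint)
open import Data.List.Relation.Binary.Permutation.Propositional as Perm using
  (_↭_; ↭-refl; ↭-reflexive; ↭-sym; ↭-trans; ↭⇒↭ₛ)
open import Data.List.Relation.Binary.Permutation.Propositional.Properties using
  (All-resp-↭; ∈-resp-↭; ↭-length; filter-↭; drop-mid; ↭-map-inv; ↭-empty-inv; ++⁺; ++⁺ˡ; shifts; ++-comm)
  renaming (map⁺ to ↭-map⁺)
open import Data.List.Relation.Binary.Pointwise using (Pointwise-≡⇒≡)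
open import Data.List.Relation.Unary.All as All using (All; []; _∷_)
import Data.List.Relation.Unary.All.Properties as All
open import Data.List.Relation.Unary.AllPairs as AllPairs using (AllPairs; []; _∷_)
import Data.List.Relation.Unary.AllPairs.Properties as AllPairs
open import Data.List.Relation.Unary.Any as Any using (here; there)
import Data.List.Relation.Unary.Any.Properties as Any
open import Data.List.Relation.Unary.Linked using ([])
open import Data.List.Relation.Unary.Linked.Properties using (Linked⇒AllPairs; AllPairs⇒Linked)
open import Data.List.Relation.Unary.Sorted.TotalOrder.Properties using (↗↭↗⇒≋)
open import Data.List.Relation.Unary.Unique.DecPropositional.Properties using (deduplicate-!)
open import Data.List.Relation.Unary.Unique.Propositional using (Unique)
import Data.List.Relation.Unary.Unique.Propositional.Properties as Unique
open import Data.Product.Base as Product using (∃; _×_; _,_; proj₁; proj₂; map₁; uncurry; swap)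
open import Data.Refinement using (value; _,_; value-injective)
open import Data.Sum.Base using (inj₁; inj₂)
open import Function.Base using (_∘_; id)
open import Function.Bundles using (mk⇔)
open import Level using (Level; _⊔_)
open import Relation.Binary.Bundles using (Setoid)
open import Relation.Binary.Core using (Rel)
open import Relation.Binary.Definitions using (tri<; tri≈; tri>) renaming (Decidable to Decidable₂)
open import Relation.Binary.PropositionalEquality as ≡ using (_≡_; _≢_; cong; cong₂; subst; subst₂)
import Relation.Binary.Reasoning.Setoid as SetoidReasoning
open import Relation.Binary.Structures using (IsDecEquivalence)
open import Relation.Binary.TypeClasses using (_≟_)
open import Relation.Nullary using
  (¬_; Dec; does; yes; no; contradiction; ¬?; _×-dec_; map′; recompute; ofʸ; ofⁿ)
open import Relation.Unary using (Pred; Decidable)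

-- The equation `#≤ b w ≡ b`, which marks the end of a prime factor, is lost when letters are
-- deleted. `GoodCut b w` says instead that the excess `#≤ a w` minus `a`, for `a ≤ b`, is smallest
-- at `a = b`. In a parking function the excess is 0 at 0 and nonnegative up to the length, so there
-- the two conditions agree. Deleting letters lowers the excess at `b` at least as much as at any
-- smaller `a`, so cuts survive; new ones may arise, but a cut only permits a change of colour and
-- never forces one. Parkization can identify distinct pairs, so the grouping into boxes and the
-- exchange of the two halves are carried out before it, on lists without repetitions. The box of
-- the pairs with empty second word is kept apart: it contributes `P π ⊗ P π∅`, the term that
-- contains the antipode of `P π`, and in all other boxes the first word is shorter than that of
-- `π`.

private
  variable
    a b ℓ₁ : Level
    A : Set a
    B : Set b

-- Formal linear combinations

module Linear {c ℓ} (K : CommutativeRing c ℓ) where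

  open CommutativeRing K hiding (zero)
  open FreeModule K
  open RingProperties ring using (-1*x≈-x)
  open CommutativeSemigroupProperties +-commutativeSemigroup using (interchange; x∙yz≈y∙xz)
  module K-Reasoning = SetoidReasoning setoid

  eval : (B → Carrier) → Lin B → Carrier
  eval φ []            = 0#
  eval φ ((k , b) ∷ x) = k * φ b + eval φ x

  infix 4 _≐_
  -- Agreement of all linear functionals: equivalent to _≋_, but more convenient
  -- and meaningful without decidable equality on the basis.
  record _≐_ {B : Set b} (x y : Lin B) : Set (b ⊔ c ⊔ ℓ) where
    constructor mk
    field at : ∀ φ → eval φ x ≈ eval φ y
  open _≐_ public

  ≐-setoid : Set b → Setoid (b ⊔ c) (b ⊔ c ⊔ ℓ)
  ≐-setoid B = record
    { Carrier = Lin B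
    ; _≈_ = _≐_
    ; isEquivalence = record
      { refl  = mk λ φ → refl
      ; sym   = λ e → mk λ φ → sym (at e φ)
      ; trans = λ e f → mk λ φ → trans (at e φ) (at f φ)
      }
    }
  module ≐ {b} {B : Set b} = Setoid (≐-setoid B)
  module ≐-Reasoning {b} {B : Set b} = SetoidReasoning (≐-setoid B)

  eval-cong : ∀ {φ ψ : B → Carrier} → (∀ b → φ b ≈ ψ b) → ∀ x → eval φ x ≈ eval ψ x
  eval-cong e []            = refl
  eval-cong e ((k , b) ∷ x) = +-cong (*-congˡ (e b)) (eval-cong e x)

  eval-++ : ∀ (φ : B → Carrier) x y → eval φ (x ++ y) ≈ eval φ x + eval φ y
  eval-++ φ []            y = sym (+-identityˡ _)
  eval-++ φ ((k , b) ∷ x) y = trans (+-congˡ (eval-++ φ x y)) (sym (+-assoc _ _ _))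

  eval-· : ∀ (φ : B → Carrier) k x → eval φ (k · x) ≈ k * eval φ x
  eval-· φ k []            = sym (zeroʳ k)
  eval-· φ k ((l , b) ∷ x) = trans (+-cong (*-assoc k l (φ b)) (eval-· φ k x)) (sym (distribˡ k _ _))

  eval-linear : ∀ (φ : B → Carrier) (f : A → Lin B) x →
                eval φ (linear f x) ≈ eval (λ a → eval φ (f a)) x
  eval-linear φ f []            = refl
  eval-linear φ f ((k , a) ∷ x) =
    trans (eval-++ φ (k · f a) (linear f x)) (+-cong (eval-· φ k (f a)) (eval-linear φ f x))

  eval-+ : ∀ (φ ψ : B → Carrier) x → eval (λ b → φ b + ψ b) x ≈ eval φ x + eval ψ x
  eval-+ φ ψ []            = sym (+-identityˡ _)
  eval-+ φ ψ ((k , b) ∷ x) =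
    trans (+-cong (distribˡ k _ _) (eval-+ φ ψ x)) (interchange _ _ _ _)

  eval-* : ∀ k (φ : B → Carrier) x → eval (λ b → k * φ b) x ≈ k * eval φ x
  eval-* k φ []            = sym (zeroʳ k)
  eval-* k φ ((l , b) ∷ x) =
    trans (+-cong (trans (sym (*-assoc l k _)) (trans (*-congʳ (*-comm l k)) (*-assoc k l _)))
                  (eval-* k φ x))
          (sym (distribˡ k _ _))

  eval-0 : ∀ (x : Lin B) → eval (λ _ → 0#) x ≈ 0#
  eval-0 []            = refl
  eval-0 ((k , b) ∷ x) = trans (+-cong (zeroʳ k) (eval-0 x)) (+-identityˡ 0#)

  eval-swap : ∀ (φ : A → B → Carrier) x y →
              eval (λ a → eval (φ a) y) x ≈ eval (λ b → eval (λ a → φ a b) x) y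
  eval-swap φ []            y = sym (eval-0 y)
  eval-swap φ ((k , a) ∷ x) y =
    trans (+-cong (sym (eval-* k (φ a) y)) (eval-swap φ x y)) (sym (eval-+ _ _ y))

  ++-cong : ∀ {x x′ y y′ : Lin B} → x ≐ x′ → y ≐ y′ → x ++ y ≐ x′ ++ y′
  ++-cong {x = x} {x′} {y} {y′} e f = mk λ φ →
    trans (eval-++ φ x y) (trans (+-cong (at e φ) (at f φ)) (sym (eval-++ φ x′ y′)))

  ·-cong : ∀ k {x y : Lin B} → x ≐ y → k · x ≐ k · y
  ·-cong k {x} {y} e = mk λ φ → trans (eval-· φ k x) (trans (*-congˡ (at e φ)) (sym (eval-· φ k y)))

  1·x≐x : ∀ (x : Lin B) → 1# · x ≐ x
  1·x≐x x = mk λ φ → trans (eval-· φ 1# x) (*-identityˡ _)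

  ++-identityʳ : ∀ (x : Lin B) → x ++ [] ≐ x
  ++-identityʳ x = mk λ φ → trans (eval-++ φ x []) (+-identityʳ _)

  linear-congˡ : ∀ {f g : A → Lin B} → (∀ a → f a ≐ g a) → ∀ x → linear f x ≐ linear g x
  linear-congˡ {f = f} {g} e x = mk λ φ → begin
    eval φ (linear f x)             ≈⟨ eval-linear φ f x ⟩
    eval (λ a → eval φ (f a)) x     ≈⟨ eval-cong (λ a → at (e a) φ) x ⟩
    eval (λ a → eval φ (g a)) x     ≈⟨ eval-linear φ g x ⟨
    eval φ (linear g x)             ∎
    where open K-Reasoning

  linear-congʳ : ∀ (f : A → Lin B) {x y} → x ≐ y → linear f x ≐ linear f y
  linear-congʳ f {x} {y} e = mk λ φ → begin
    eval φ (linear f x)             ≈⟨ eval-linear φ f x ⟩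
    eval (λ a → eval φ (f a)) x     ≈⟨ at e _ ⟩
    eval (λ a → eval φ (f a)) y     ≈⟨ eval-linear φ f y ⟨
    eval φ (linear f y)             ∎
    where open K-Reasoning

  linear-linear : ∀ {d} {D : Set d} (f : B → Lin D) (g : A → Lin B) x →
                  linear f (linear g x) ≐ linear (λ a → linear f (g a)) x
  linear-linear f g x = mk λ φ → begin
    eval φ (linear f (linear g x))                        ≈⟨ eval-linear φ f (linear g x) ⟩
    eval (λ b → eval φ (f b)) (linear g x)                ≈⟨ eval-linear _ g x ⟩
    eval (λ a → eval (λ b → eval φ (f b)) (g a)) x        ≈⟨ eval-cong (λ a → sym (eval-linear φ f (g a))) x ⟩
    eval (λ a → eval φ (linear f (g a))) x                ≈⟨ eval-linear φ _ x ⟨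
    eval φ (linear (λ a → linear f (g a)) x)              ∎
    where open K-Reasoning

  linear-++ : ∀ (f : A → Lin B) x y → linear f (x ++ y) ≐ linear f x ++ linear f y
  linear-++ f x y = ≐.reflexive (concatMap-++ _ x y)

  linear-basis : ∀ (f : A → Lin B) a → linear f (basis a) ≐ f a
  linear-basis f a = ≐.trans (++-identityʳ _) (1·x≐x (f a))

  linear-basis-id : ∀ (x : Lin B) → linear basis x ≐ x
  linear-basis-id x = mk λ φ → trans (eval-linear φ basis x)
    (eval-cong (λ b → trans (+-identityʳ _) (*-identityˡ (φ b))) x)

  linear-· : ∀ (f : A → Lin B) k x → linear f (k · x) ≐ k · linear f x
  linear-· f k x = mk λ φ → begin
    eval φ (linear f (k · x))                ≈⟨ eval-linear φ f (k · x) ⟩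
    eval (λ a → eval φ (f a)) (k · x)        ≈⟨ eval-· _ k x ⟩
    k * eval (λ a → eval φ (f a)) x          ≈⟨ *-congˡ (eval-linear φ f x) ⟨
    k * eval φ (linear f x)                  ≈⟨ eval-· φ k (linear f x) ⟨
    eval φ (k · linear f x)                  ∎
    where open K-Reasoning

  linear-swap : ∀ {d} {D : Set d} (f : A → B → Lin D) x y →
                linear (λ a → linear (f a) y) x ≐ linear (λ b → linear (λ a → f a b) x) y
  linear-swap f x y = mk λ φ → begin
    eval φ (linear (λ a → linear (f a) y) x)                ≈⟨ eval-linear φ _ x ⟩
    eval (λ a → eval φ (linear (f a) y)) x                  ≈⟨ eval-cong (λ a → eval-linear φ (f a) y) x ⟩
    eval (λ a → eval (λ b → eval φ (f a b)) y) x            ≈⟨ eval-swap _ x y ⟩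
    eval (λ b → eval (λ a → eval φ (f a b)) x) y            ≈⟨ eval-cong (λ b → eval-linear φ (λ a → f a b) x) y ⟨
    eval (λ b → eval φ (linear (λ a → f a b) x)) y          ≈⟨ eval-linear φ _ y ⟨
    eval φ (linear (λ b → linear (λ a → f a b) x) y)        ∎
    where open K-Reasoning

  linear-concatMap : ∀ {i} {I : Set i} (f : A → Lin B) (g : I → Lin A) xs →
                     linear f (concatMap g xs) ≐ concatMap (linear f ∘ g) xs
  linear-concatMap f g []       = ≐.refl
  linear-concatMap f g (x ∷ xs) =
    ≐.trans (linear-++ f (g x) (concatMap g xs)) (++-cong ≐.refl (linear-concatMap f g xs))

  concatMap-≐ : {f g : A → Lin B} → (∀ a → f a ≐ g a) → ∀ xs → concatMap f xs ≐ concatMap g xs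
  concatMap-≐ e []       = ≐.refl
  concatMap-≐ e (x ∷ xs) = ++-cong (e x) (concatMap-≐ e xs)

  ∑-↭ : ∀ {xs ys : List B} → xs ↭ ys → ∑ xs ≐ ∑ ys
  ∑-↭ xs↭ys = mk λ φ → go φ xs↭ys
    where
    go : ∀ (φ : B → Carrier) {xs ys} → xs ↭ ys → eval φ (∑ xs) ≈ eval φ (∑ ys)
    go φ Perm.refl         = refl
    go φ (Perm.prep x p)   = +-congˡ (go φ p)
    go φ (Perm.swap x y p) = trans (x∙yz≈y∙xz _ _ _) (+-congˡ (+-congˡ (go φ p)))
    go φ (Perm.trans p q)  = trans (go φ p) (go φ q)

  linear-∑ : ∀ {f : A → Lin B} {g : A → List B} → (∀ a → f a ≐ ∑ (g a)) →
             ∀ xs → linear f (∑ xs) ≐ ∑ (concatMap g xs)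
  linear-∑ e []       = ≐.refl
  linear-∑ {f = f} {g} e (x ∷ xs) = ≐.trans
    (++-cong (≐.trans (1·x≐x (f x)) (e x)) (linear-∑ e xs))
    (≐.reflexive (≡.sym (map-++ _ (g x) (concatMap g xs))))

  ∑-⊗-∑ : ∀ (xs : List A) (ys : List B) → ∑ xs ⊗ ∑ ys ≐ ∑ (cartesianProduct xs ys)
  ∑-⊗-∑ []       ys = ≐.refl
  ∑-⊗-∑ {A = A} {B = B} (x ∷ xs) ys = ≐.trans
    (++-cong (≐.trans (1·x≐x _) (inner ys)) (∑-⊗-∑ xs ys))
    (≐.reflexive (≡.sym (map-++ _ (map (x ,_) ys) _)))
    where
    inner : (ys : List B) → linear (λ b → basis (x , b)) (∑ ys) ≐ ∑ (map (x ,_) ys)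
    inner []       = ≐.refl
    inner (y ∷ ys) = ++-cong (1·x≐x _) (inner ys)

  module _ {B : Set b} ⦃ _ : IsDecEquivalence {A = B} _≡_ ⦄ where

    δ : B → B → Carrier
    δ b a = if does (a ≟ b) then 1# else 0#

    δ-refl : ∀ b → δ b b ≈ 1#
    δ-refl b with b ≟ b
    ... | yes _ = refl
    ... | no ¬p = contradiction ≡.refl ¬p

    δ-≢ : ∀ {a b} → a ≢ b → δ b a ≈ 0#
    δ-≢ {a} {b} a≢b with a ≟ b
    ... | yes a≡b = contradiction a≡b a≢b
    ... | no _    = refl

    coeff≈eval : ∀ x b → coeff x b ≈ eval (δ b) x
    coeff≈eval []             b = refl
    coeff≈eval ((k , a) ∷ x) b with a ≟ b
    ... | yes _ = +-cong (sym (*-identityʳ k)) (coeff≈eval x b)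
    ... | no _  = +-cong (sym (zeroʳ k)) (coeff≈eval x b)

    ≐⇒≋ : ∀ {x y : Lin B} → x ≐ y → x ≋ y
    ≐⇒≋ {x} {y} e b = trans (coeff≈eval x b) (trans (at e _) (sym (coeff≈eval y b)))

    sumOver : List B → (B → Carrier) → Carrier
    sumOver L ψ = foldr (λ b s → ψ b + s) 0# L

    sumOver-cong : ∀ {L ψ ψ′} → All (λ b → ψ b ≈ ψ′ b) L → sumOver L ψ ≈ sumOver L ψ′
    sumOver-cong []       = refl
    sumOver-cong (e ∷ es) = +-cong e (sumOver-cong es)

    sumOver-0 : ∀ L → sumOver L (λ _ → 0#) ≈ 0#
    sumOver-0 []      = refl
    sumOver-0 (x ∷ L) = trans (+-identityˡ _) (sumOver-0 L)

    sumOver-+ : ∀ L (ψ ψ′ : B → Carrier) → sumOver L (λ b → ψ b + ψ′ b) ≈ sumOver L ψ + sumOver L ψ′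
    sumOver-+ []      ψ ψ′ = sym (+-identityˡ _)
    sumOver-+ (x ∷ L) ψ ψ′ = trans (+-congˡ (sumOver-+ L ψ ψ′)) (interchange _ _ _ _)

    δ*-refl : ∀ b k (φ : B → Carrier) → (if does (b ≟ b) then k else 0#) * φ b ≈ k * φ b
    δ*-refl b k φ with b ≟ b
    ... | yes _ = refl
    ... | no ¬p = contradiction ≡.refl ¬p

    δ*-≢ : ∀ {a b} k (φ : B → Carrier) → a ≢ b → (if does (a ≟ b) then k else 0#) * φ b ≈ 0#
    δ*-≢ {a} {b} k φ a≢b with a ≟ b
    ... | yes a≡b = contradiction a≡b a≢b
    ... | no _    = zeroˡ _

    sumOver-δ : ∀ {L} → Unique L → ∀ {a} → a ∈ L → ∀ k (φ : B → Carrier) →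
                sumOver L (λ b → (if does (a ≟ b) then k else 0#) * φ b) ≈ k * φ a
    sumOver-δ {x ∷ L} (x∉L ∷ _) (here ≡.refl) k φ = trans
      (+-cong (δ*-refl x k φ) (trans (sumOver-cong (All.map (δ*-≢ k φ) x∉L)) (sumOver-0 L)))
      (+-identityʳ _)
    sumOver-δ {x ∷ L} (x∉L ∷ u) (there a∈L) k φ = trans
      (+-cong (δ*-≢ k φ (λ a≡x → All.lookup x∉L a∈L (≡.sym a≡x))) (sumOver-δ u a∈L k φ))
      (+-identityˡ _)

    eval≈sumOver : ∀ {L} → Unique L → ∀ φ x → All (λ (_ , b) → b ∈ L) x →
                   eval φ x ≈ sumOver L (λ b → coeff x b * φ b)
    eval≈sumOver {L} u φ [] [] = sym (trans (sumOver-cong (All.universal (λ b → zeroˡ (φ b)) L)) (sumOver-0 L))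
    eval≈sumOver {L} u φ ((k , a) ∷ x) (a∈L ∷ x⊆L) = begin
      k * φ a + eval φ x
        ≈⟨ +-cong (sym (sumOver-δ u a∈L k φ)) (eval≈sumOver u φ x x⊆L) ⟩
      sumOver L (λ b → (if does (a ≟ b) then k else 0#) * φ b) + sumOver L (λ b → coeff x b * φ b)
        ≈⟨ sumOver-+ L _ _ ⟨
      sumOver L (λ b → (if does (a ≟ b) then k else 0#) * φ b + coeff x b * φ b)
        ≈⟨ sumOver-cong (All.universal (λ b → sym (distribʳ (φ b) _ _)) L) ⟩
      sumOver L (λ b → coeff ((k , a) ∷ x) b * φ b) ∎
      where open K-Reasoning

    -- Both combinations are supported on the finite list `L` of basis elements occurring in either.
    -- Summing over this common, repetition-free `L` expresses every functional through the
    -- coefficients alone.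
    ≋⇒≐ : ∀ (x y : Lin B) → x ≋ y → x ≐ y
    ≋⇒≐ x y e = mk λ φ → trans (eval≈sumOver u φ x x⊆L)
        (trans (sumOver-cong (All.universal (λ b → *-congʳ (e b)) L)) (sym (eval≈sumOver u φ y y⊆L)))
      where
      L : List B
      L = deduplicate _≟_ (map proj₂ (x ++ y))
      u : Unique L
      u = deduplicate-! _≟_ (map proj₂ (x ++ y))
      xy⊆L : All (λ (_ , b) → b ∈ L) (x ++ y)
      xy⊆L = All.map⁻ (All.tabulate (∈-deduplicate⁺ _≟_))
      x⊆L : All (λ (_ , b) → b ∈ L) x
      x⊆L = All.++⁻ˡ x xy⊆L
      y⊆L : All (λ (_ , b) → b ∈ L) y
      y⊆L = All.++⁻ʳ x xy⊆L

    coeff-∑-∉ : ∀ {xs b} → All (_≢ b) xs → coeff (∑ xs) b ≈ 0#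
    coeff-∑-∉ []                     = refl
    coeff-∑-∉ {x ∷ xs} {b} (x≢b ∷ h) = trans (+-cong (δ-≢ x≢b) (coeff-∑-∉ h)) (+-identityˡ 0#)

    coeff-∑-∈ : ∀ {xs b} → Unique xs → b ∈ xs → coeff (∑ xs) b ≈ 1#
    coeff-∑-∈ {x ∷ xs} (x∉ ∷ u) (here ≡.refl) =
      trans (+-cong (δ-refl x) (coeff-∑-∉ (All.map ≡.≢-sym x∉))) (+-identityʳ 1#)
    coeff-∑-∈ {x ∷ xs} (x∉ ∷ u) (there b∈xs)  =
      trans (+-cong (δ-≢ (All.lookup x∉ b∈xs)) (coeff-∑-∈ u b∈xs)) (+-identityˡ 1#)

    record IsSubmodule (V : Pred (Lin B) ℓ₁) : Set (b ⊔ c ⊔ ℓ ⊔ ℓ₁) where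
      field
        ≐-closed : ∀ {x y} → x ≐ y → V x → V y
        0-closed : V 0ᴸ
        +-closed : ∀ {x y} → V x → V y → V (x +ᴸ y)
        ·-closed : ∀ k {x} → V x → V (k · x)

      linear-closed : {f : A → Lin B} → (∀ a → V (f a)) → ∀ k → V (linear f k)
      linear-closed h []            = 0-closed
      linear-closed h ((k , a) ∷ x) = +-closed (·-closed k (h a)) (linear-closed h x)

      concatMap-closed : {f : A → Lin B} {xs : List A} → All (λ a → V (f a)) xs → V (concatMap f xs)
      concatMap-closed []       = 0-closed
      concatMap-closed (h ∷ hs) = +-closed h (concatMap-closed hs)

      -- Subtraction is addition of a multiple by `- 1#`. This is the step that isolates the unknown
      -- term in the equation for the antipode.
      cancelʳ-closed : ∀ {x y} → V (x +ᴸ y) → V y → V x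
      cancelʳ-closed {x} {y} hxy hy = ≐-closed
        (mk λ φ → begin
          eval φ ((x ++ y) ++ (- 1# · y))           ≈⟨ eval-++ φ (x ++ y) (- 1# · y) ⟩
          eval φ (x ++ y) + eval φ (- 1# · y)       ≈⟨ +-cong (eval-++ φ x y) (trans (eval-· φ (- 1#) y) (-1*x≈-x _)) ⟩
          (eval φ x + eval φ y) + - eval φ y        ≈⟨ +-assoc _ _ _ ⟩
          eval φ x + (eval φ y + - eval φ y)        ≈⟨ +-congˡ (-‿inverseʳ _) ⟩
          eval φ x + 0#                             ≈⟨ +-identityʳ _ ⟩
          eval φ x                                  ∎)
        (+-closed hxy (·-closed (- 1#) hy))
        where open K-Reasoning

  module _ {I : Set a} {B : Set b}
    ⦃ _ : IsDecEquivalence {A = I} _≡_ ⦄ ⦃ _ : IsDecEquivalence {A = B} _≡_ ⦄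
    (v : I → Lin B) where

    Span-isSubmodule : IsSubmodule (Span v)
    Span-isSubmodule = record
      { ≐-closed = λ { e (k , h) → k , λ b → trans (sym (≐⇒≋ e b)) (h b) }
      ; 0-closed = [] , λ b → refl
      ; +-closed = λ { {x} {y} (k , h) (l , g) → k ++ l ,
          ≐⇒≋ (≐.trans (++-cong (≋⇒≐ x (linear v k) h) (≋⇒≐ y (linear v l) g)) (≐.sym (linear-++ v k l))) }
      ; ·-closed = λ { m {x} (k , h) → m · k ,
          ≐⇒≋ (≐.trans (·-cong m (≋⇒≐ x (linear v k) h)) (≐.sym (linear-· v m k))) }
      }

    Span-member : ∀ i → Span v (v i)
    Span-member i = basis i , ≐⇒≋ (≐.sym (linear-basis v i))

    -- Reduces closure of a span under a linear map to the generators; all the closure properties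
    -- below pass through it.
    Span-linear : ∀ {d} {D : Set d} ⦃ _ : IsDecEquivalence {A = D} _≡_ ⦄ {q} {W : Pred (Lin D) q} →
                  IsSubmodule W → {f : B → Lin D} → (∀ i → W (linear f (v i))) →
                  ∀ {x} → Span v x → W (linear f x)
    Span-linear W-sub {f} h {x} (k , e) = ≐-closed
      (≐.trans (≐.sym (linear-linear f v k)) (linear-congʳ f (≐.sym (≋⇒≐ x (linear v k) e))))
      (linear-closed h k)
      where open IsSubmodule W-sub

    -- The coefficient functionals at the `e j` form a dual system to the family `v`: applied to a
    -- relation, the one at `e j` reads off its coefficient at `j`.
    independent : ∀ (e : I → B) → (∀ i j → coeff (v i) (e j) ≈ δ j i) → LinearlyIndependent v
    independent e h k z j = begin
      coeff k j                             ≈⟨ coeff≈eval k j ⟩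
      eval (δ j) k                          ≈⟨ eval-cong (λ i → trans (sym (h i j)) (coeff≈eval (v i) (e j))) k ⟩
      eval (λ i → eval (δ (e j)) (v i)) k   ≈⟨ eval-linear _ v k ⟨
      eval (δ (e j)) (linear v k)           ≈⟨ coeff≈eval (linear v k) (e j) ⟨
      coeff (linear v k) (e j)              ≈⟨ z (e j) ⟩
      0#                                    ∎
      where open K-Reasoning

  module _ {B : Set b} ⦃ _ : IsDecEquivalence {A = B} _≡_ ⦄ (H : StructureMaps B)
           {V : Pred (Lin B) ℓ₁} (V-sub : IsSubmodule V) where

    open IsSubmodule V-sub

    TensorSquare-isSubmodule : IsSubmodule (TensorSquare H V)
    TensorSquare-isSubmodule = record
      { ≐-closed = λ { e (ts , hs , h) → ts , hs , λ b → trans (sym (≐⇒≋ e b)) (h b) }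
      ; 0-closed = [] , [] , λ b → refl
      ; +-closed = λ { {x} {y} (ts , hs , h) (us , gs , g) → ts ++ us , All.++⁺ hs gs ,
          ≐⇒≋ (≐.trans (++-cong (≋⇒≐ x (tensors ts) h) (≋⇒≐ y (tensors us) g))
                       (≐.reflexive (≡.sym (concatMap-++ (uncurry _⊗_) ts us)))) }
      ; ·-closed = λ { k {x} (ts , hs , h) → map (map₁ (k ·_)) ts ,
          All.map⁺ (All.map (λ (p , q) → ·-closed k p , q) hs) ,
          ≐⇒≋ (≐.trans (·-cong k (≋⇒≐ x (tensors ts) h)) (scale k ts)) }
      }
      where
      tensors : List (Lin B × Lin B) → Lin (B × B)
      tensors = concatMap (uncurry _⊗_)
      scale : ∀ k (ts : List (Lin B × Lin B)) →
              k · tensors ts ≐ tensors (map (map₁ (k ·_)) ts)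
      scale k []             = ≐.refl
      scale k ((x , y) ∷ ts) = ≐.trans
        (≐.reflexive (map-++ _ (x ⊗ y) _))
        (++-cong (≐.sym (linear-· _ k x)) (scale k ts))

open ≡ using (refl; sym; trans)
open import Data.Nat.Base using
  (ℕ; zero; suc; pred; _+_; _∸_; _≤_; _<_; _≤ᵇ_; _<ᵇ_; _≡ᵇ_; z≤n; s≤s; s≤s⁻¹)
open import Data.Nat.ListAction using (sum)
open import Data.Nat.ListAction.Properties using (sum-↭)
open import Data.Nat.Properties as ℕ using (_≤?_; ≤-refl; ≤-trans)
open import Data.List.Relation.Unary.Sorted.TotalOrder ℕ.≤-totalOrder using (Sorted; sorted?)
import Data.List.Sort ℕ.≤-decTotalOrder as Sort
open CommutativeSemigroupProperties ℕ.+-commutativeSemigroup using (interchange)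

-- Lists without repetitions

Unique-↭ : {xs ys : List A} → Unique xs → Unique ys →
           (∀ {x} → x ∈ xs → x ∈ ys) → (∀ {x} → x ∈ ys → x ∈ xs) → xs ↭ ys
Unique-↭ u u′ to from = ∼bag⇒↭ (unique∧set⇒bag u u′ (mk⇔ to from))

map-injective-↭ : {f : A → B} → (∀ {x y} → f x ≡ f y → x ≡ y) →
                  ∀ {xs ys} → map f xs ↭ map f ys → xs ↭ ys
map-injective-↭ {f = f} inj p with ↭-map-inv f p
... | _ , eq , q = ↭-trans q (↭-reflexive (map-injective inj (sym eq)))

∈-concatMap-intro : ∀ (f : A → List B) {xs x y} → x ∈ xs → y ∈ f x → y ∈ concatMap f xs
∈-concatMap-intro f x∈xs y∈fx = ∈-concatMap⁺ f (lose x∈xs y∈fx)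

∈-concatMap-elim : ∀ (f : A → List B) xs {y} → y ∈ concatMap f xs → ∃ λ x → x ∈ xs × y ∈ f x
∈-concatMap-elim f xs y∈ = find (∈-concatMap⁻ f {xs} y∈)

Unique-map-on : {f : A → B} {xs : List A} → (∀ {x y} → x ∈ xs → y ∈ xs → f x ≡ f y → x ≡ y) →
                Unique xs → Unique (map f xs)
Unique-map-on inj []       = []
Unique-map-on inj (x∉ ∷ u) =
  All.map⁺ (All.tabulate λ y∈ eq → All.lookup x∉ y∈ (inj (here refl) (there y∈) eq)) ∷
  Unique-map-on (λ x∈ y∈ → inj (there x∈) (there y∈)) u

Unique-concatMap : {f : A → List B} {xs : List A} →
                   All (Unique ∘ f) xs → AllPairs (λ x y → Disjoint (f x) (f y)) xs →
                   Unique (concatMap f xs)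
Unique-concatMap us ds = Unique.concat⁺ (All.map⁺ us) (AllPairs.map⁺ ds)

-- `g` recovers the index from any element of its list, so lists with different indices cannot meet.
-- Concatenation plays this role for pairs of words, filtering by size for shifted shuffles.
retraction⇒Disjoint : {f : A → List B} (g : B → A) {xs : List A} → Unique xs →
                      (∀ {x y} → x ∈ xs → y ∈ f x → g y ≡ x) →
                      AllPairs (λ x y → Disjoint (f x) (f y)) xs
retraction⇒Disjoint g []       r = []
retraction⇒Disjoint g (x∉ ∷ u) r =
  All.tabulate (λ y∈ → λ { (z∈fx , z∈fy) →
    All.lookup x∉ y∈ (trans (sym (r (here refl) z∈fx)) (r (there y∈) z∈fy)) }) ∷
  retraction⇒Disjoint g u (r ∘ there)

∈-insertions : ∀ (x : A) ys zs → ys ++ x ∷ zs ∈ insertions x (ys ++ zs)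
∈-insertions x []       []       = here refl
∈-insertions x []       (z ∷ zs) = here refl
∈-insertions x (y ∷ ys) zs       = there (∈-map⁺ (y ∷_) (∈-insertions x ys zs))

∈-permutations : ∀ {v w : List A} → v ↭ w → v ∈ permutations w
∈-permutations {w = []}    p rewrite ↭-empty-inv p = here refl
∈-permutations {w = x ∷ w} p with ∈-∃++ (∈-resp-↭ (↭-sym p) (here refl))
... | ys , zs , refl = ∈-concatMap-intro (insertions x)
  (∈-permutations {w = w} (drop-mid ys [] p)) (∈-insertions x ys zs)

∈-rearrangements⁺ : ∀ {v w} → v ↭ w → v ∈ rearrangements w
∈-rearrangements⁺ p = ∈-deduplicate⁺ _≟_ (∈-permutations p)

∈-rearrangements⁻ : ∀ {v w} → v ∈ rearrangements w → v ↭ w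
∈-rearrangements⁻ {w = w} v∈ = All.lookup (permutations-↭ w) (∈-deduplicate⁻ _≟_ (permutations w) v∈)

rearrangements-unique : ∀ w → Unique (rearrangements w)
rearrangements-unique w = deduplicate-! _≟_ (permutations w)

infix 4 _↭?_
-- Needed to choose one representative for each pair of multisets.
_↭?_ : (v w : CWord) → Dec (v ↭ w)
v ↭? w = map′ (∈-rearrangements⁻ {w = w}) ∈-rearrangements⁺ (v ∈? rearrangements w)
  where open DecMembership _≟_ using (_∈?_)

rearrangements-cong : ∀ {v w} → v ↭ w → rearrangements v ↭ rearrangements w
rearrangements-cong {v} {w} p = Unique-↭ (rearrangements-unique v) (rearrangements-unique w)
  (λ u∈ → ∈-rearrangements⁺ (↭-trans (∈-rearrangements⁻ {w = v} u∈) p))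
  (λ u∈ → ∈-rearrangements⁺ (↭-trans (∈-rearrangements⁻ {w = w} u∈) (↭-sym p)))

-- Tailored to parkization, which is not a letterwise map on all words but acts by one and the same
-- letter map `g` on all rearrangements of a given `w`. Injectivity of `g` on the letters of `w`
-- prevents multiplicities.
rearrangements-map : ∀ (f : CWord → CWord) (g : ℕ × Color → ℕ × Color) w →
  (∀ {u} → u ↭ w → f u ≡ map g u) → (∀ {x y} → x ∈ w → y ∈ w → g x ≡ g y → x ≡ y) →
  map f (rearrangements w) ↭ rearrangements (map g w)
rearrangements-map f g w f≡g inj = ↭-trans (↭-reflexive eq)
  (Unique-↭ (Unique-map-on inj′ (rearrangements-unique w)) (rearrangements-unique (map g w)) to from)
  where
  eq : map f (rearrangements w) ≡ map (map g) (rearrangements w)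
  eq = map-cong-local (All.tabulate (λ u∈ → f≡g (∈-rearrangements⁻ {w = w} u∈)))
  map-inj : ∀ {xs ys} → All (_∈ w) xs → All (_∈ w) ys → map g xs ≡ map g ys → xs ≡ ys
  map-inj []       []       e = refl
  map-inj (p ∷ ps) (q ∷ qs) e = cong₂ _∷_ (inj p q (∷-injectiveˡ e)) (map-inj ps qs (∷-injectiveʳ e))
  ⊆w : ∀ {u} → u ∈ rearrangements w → All (_∈ w) u
  ⊆w u∈ = All.tabulate (∈-resp-↭ (∈-rearrangements⁻ {w = w} u∈))
  inj′ : ∀ {u v} → u ∈ rearrangements w → v ∈ rearrangements w → map g u ≡ map g v → u ≡ v
  inj′ u∈ v∈ = map-inj (⊆w u∈) (⊆w v∈)
  to : ∀ {u} → u ∈ map (map g) (rearrangements w) → u ∈ rearrangements (map g w)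
  to u∈ with ∈-map⁻ (map g) u∈
  ... | v , v∈ , refl = ∈-rearrangements⁺ (↭-map⁺ g (∈-rearrangements⁻ {w = w} v∈))
  from : ∀ {u} → u ∈ rearrangements (map g w) → u ∈ map (map g) (rearrangements w)
  from u∈ with ↭-map-inv g (↭-sym (∈-rearrangements⁻ {w = map g w} u∈))
  ... | v , refl , p = ∈-map⁺ (map g) (∈-rearrangements⁺ (↭-sym p))

-- Shuffles of two words whose letters are told apart by a predicate

shuffles-[]ʳ : ∀ (xs : List A) → shuffles xs [] ≡ xs ∷ []
shuffles-[]ʳ []       = refl
shuffles-[]ʳ (x ∷ xs) = refl

∈-shuffles-∷ˡ : ∀ {x : A} {u xs} ys → u ∈ shuffles xs ys → x ∷ u ∈ shuffles (x ∷ xs) ys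
∈-shuffles-∷ˡ {xs = xs} [] u∈ rewrite shuffles-[]ʳ xs with u∈
... | here refl = here refl
∈-shuffles-∷ˡ (y ∷ ys) u∈ = ∈-++⁺ˡ (∈-map⁺ (_ ∷_) u∈)

∈-shuffles-∷ʳ : ∀ {y : A} {u ys} xs → u ∈ shuffles xs ys → y ∷ u ∈ shuffles xs (y ∷ ys)
∈-shuffles-∷ʳ []       (here refl) = here refl
∈-shuffles-∷ʳ (x ∷ xs) u∈ = ∈-++⁺ʳ (map (x ∷_) (shuffles xs (_ ∷ _))) (∈-map⁺ (_ ∷_) u∈)

module _ {A : Set a} {P : Pred A ℓ₁} (P? : Decidable P) where

  private
    ¬P? : Decidable (¬_ ∘ P)
    ¬P? = ¬? ∘ P?

    filter-¬¬ : ∀ {xs} → All P xs → filter ¬P? xs ≡ []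
    filter-¬¬ ps = filter-none ¬P? (All.map (λ p ¬p → ¬p p) ps)

  -- Filtering undoes shuffling, because every letter reveals from which word it came; `∈-shuffles`
  -- is the converse.
  shuffles-filter : ∀ {xs ys} → All P xs → All (¬_ ∘ P) ys → ∀ {u} → u ∈ shuffles xs ys →
                    filter P? u ≡ xs × filter ¬P? u ≡ ys
  shuffles-filter []       ns (here refl) = filter-none P? ns , filter-all ¬P? ns
  shuffles-filter (p ∷ ps) [] (here refl) = filter-all P? (p ∷ ps) , filter-¬¬ (p ∷ ps)
  shuffles-filter {x ∷ xs} {y ∷ ys} (p ∷ ps) (n ∷ ns) u∈ with ∈-++⁻ (map (x ∷_) (shuffles xs (y ∷ ys))) u∈
  ... | inj₁ h with ∈-map⁻ (x ∷_) h
  ...   | v , v∈ , refl with P? x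
  ...     | yes _ = let e , e′ = shuffles-filter ps (n ∷ ns) v∈ in cong (x ∷_) e , e′
  ...     | no ¬p = contradiction p ¬p
  shuffles-filter {x ∷ xs} {y ∷ ys} (p ∷ ps) (n ∷ ns) u∈ | inj₂ h with ∈-map⁻ (y ∷_) h
  ...   | v , v∈ , refl with P? y
  ...     | yes q = contradiction q n
  ...     | no _  = let e , e′ = shuffles-filter (p ∷ ps) ns v∈ in e , cong (y ∷_) e′

  ∈-shuffles : ∀ u → u ∈ shuffles (filter P? u) (filter ¬P? u)
  ∈-shuffles []      = here refl
  ∈-shuffles (x ∷ u) with P? x
  ... | yes _ = ∈-shuffles-∷ˡ (filter ¬P? u) (∈-shuffles u)
  ... | no _  = ∈-shuffles-∷ʳ (filter P? u) (∈-shuffles u)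

  shuffles-unique : ∀ {xs ys} → All P xs → All (¬_ ∘ P) ys → Unique (shuffles xs ys)
  shuffles-unique []       ns = [] ∷ []
  shuffles-unique (p ∷ ps) [] = [] ∷ []
  shuffles-unique {x ∷ xs} {y ∷ ys} (p ∷ ps) (n ∷ ns) = Unique.++⁺
    (Unique.map⁺ ∷-injectiveʳ (shuffles-unique ps (n ∷ ns)))
    (Unique.map⁺ ∷-injectiveʳ (shuffles-unique (p ∷ ps) ns))
    disjoint
    where
    disjoint : Disjoint (map (x ∷_) (shuffles xs (y ∷ ys))) (map (y ∷_) (shuffles (x ∷ xs) ys))
    disjoint (u∈ , v∈) with ∈-map⁻ (x ∷_) u∈ | ∈-map⁻ (y ∷_) v∈
    ... | _ , _ , refl | _ , _ , refl = n p

  filter-++-↭ : ∀ {u xs ys} → All P xs → All (¬_ ∘ P) ys → u ↭ xs ++ ys →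
                filter P? u ↭ xs × filter ¬P? u ↭ ys
  filter-++-↭ {u} {xs} {ys} ps ns q =
    ↭-trans (filter-↭ P? q) (↭-reflexive (trans (filter-++ P? xs ys)
      (trans (cong₂ _++_ (filter-all P? ps) (filter-none P? ns)) (List.++-identityʳ xs)))) ,
    ↭-trans (filter-↭ ¬P? q) (↭-reflexive (trans (filter-++ ¬P? xs ys)
      (cong₂ _++_ (filter-¬¬ ps) (filter-all ¬P? ns))))

-- Deconcatenations of all rearrangements of a word

splitAts : List A → List (List A × List A)
splitAts w = map (λ i → take i w , drop i w) (upTo (suc (length w)))

∈-splitAts⁻ : ∀ (w : List A) {u v} → (u , v) ∈ splitAts w → u ++ v ≡ w
∈-splitAts⁻ w uv∈ with ∈-map⁻ (λ i → take i w , drop i w) {xs = upTo (suc (length w))} uv∈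
... | i , _ , refl = take++drop≡id i w

take-drop-++ : ∀ (u v : List A) → (take (length u) (u ++ v) , drop (length u) (u ++ v)) ≡ (u , v)
take-drop-++ []      v = refl
take-drop-++ (x ∷ u) v = cong (λ (s , t) → x ∷ s , t) (take-drop-++ u v)

∈-splitAts⁺ : ∀ (u v : List A) → (u , v) ∈ splitAts (u ++ v)
∈-splitAts⁺ u v = subst (_∈ splitAts (u ++ v)) (take-drop-++ u v)
  (∈-map⁺ (λ i → take i (u ++ v) , drop i (u ++ v))
    (∈-upTo⁺ (s≤s (ℕ.≤-trans (ℕ.m≤m+n _ _) (ℕ.≤-reflexive (sym (length-++ u)))))))

splitAts-unique : ∀ (w : List A) → Unique (splitAts w)
splitAts-unique w = Unique-map-on
  (λ {i} {j} i∈ j∈ eq → trans (sym (len i∈)) (trans (cong (length ∘ proj₁) eq) (len j∈)))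
  (Unique.upTo⁺ (suc (length w)))
  where
  len : ∀ {i} → i ∈ upTo (suc (length w)) → length (take i w) ≡ i
  len {i} i∈ = trans (length-take i w) (ℕ.m≤n⇒m⊓n≡m (s≤s⁻¹ (∈-upTo⁻ i∈)))

deconcatenations : CWord → List (CWord × CWord)
deconcatenations w = concatMap splitAts (rearrangements w)

∈-deconcatenations⁺ : ∀ {w} u v → u ++ v ↭ w → (u , v) ∈ deconcatenations w
∈-deconcatenations⁺ u v p = ∈-concatMap-intro splitAts (∈-rearrangements⁺ p) (∈-splitAts⁺ u v)

∈-deconcatenations⁻ : ∀ w {u v} → (u , v) ∈ deconcatenations w → u ++ v ↭ w
∈-deconcatenations⁻ w uv∈ with ∈-concatMap-elim splitAts (rearrangements w) uv∈
... | x , x∈ , uv∈x = ↭-trans (↭-reflexive (∈-splitAts⁻ x uv∈x)) (∈-rearrangements⁻ {w = w} x∈)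

deconcatenations-unique : ∀ w → Unique (deconcatenations w)
deconcatenations-unique w = Unique-concatMap (All.universal splitAts-unique (rearrangements w))
  (retraction⇒Disjoint (λ (u , v) → u ++ v) (rearrangements-unique w) (λ {x} _ → ∈-splitAts⁻ x))

box : CWord × CWord → List (CWord × CWord)
box (u , v) = cartesianProduct (rearrangements u) (rearrangements v)

box-unique : ∀ r → Unique (box r)
box-unique (u , v) = Unique.cartesianProduct⁺ (rearrangements-unique u) (rearrangements-unique v)

infix 4 _↭₂_
_↭₂_ : Rel (CWord × CWord) _
(u , v) ↭₂ (u′ , v′) = u ↭ u′ × v ↭ v′

_↭₂?_ : Decidable₂ _↭₂_
(u , v) ↭₂? (u′ , v′) = (u ↭? u′) ×-dec (v ↭? v′)

∈-box⁺ : ∀ {s r} → s ↭₂ r → s ∈ box r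
∈-box⁺ (p , q) = ∈-cartesianProduct⁺ (∈-rearrangements⁺ p) (∈-rearrangements⁺ q)

∈-box⁻ : ∀ {s r} → s ∈ box r → s ↭₂ r
∈-box⁻ {r = u , v} s∈ with ∈-cartesianProduct⁻ (rearrangements u) (rearrangements v) s∈
... | p , q = ∈-rearrangements⁻ {w = u} p , ∈-rearrangements⁻ {w = v} q

-- Each box consists of the pairs with given multisets of letters.
deconcatenations-boxes : ∀ w → ∃ λ rs →
  All (λ (u , v) → u ++ v ↭ w × length u < length w) rs ×
  deconcatenations w ↭ concatMap box ((w , []) ∷ rs)
deconcatenations-boxes w = reps , All.tabulate spec ,
  Unique-↭ (deconcatenations-unique w)
    (Unique-concatMap (All.universal box-unique ((w , []) ∷ reps)) (All.tabulate sep₀ ∷ AllPairs.map sep (pairs proper)))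
    to from
  where
  -- The pairs with empty second word make up the single box of `(w , [])`. In every other pair the
  -- first word is strictly shorter than `w`, as the induction for the antipode requires.
  0<length? : Decidable (λ (s : CWord × CWord) → 0 < length (proj₂ s))
  0<length? (u , v) = 0 ℕ.<? length v

  proper reps : List (CWord × CWord)
  proper = filter 0<length? (deconcatenations w)
  reps   = deduplicate _↭₂?_ proper

  ∈-reps : ∀ {s} → s ∈ reps → s ∈ deconcatenations w × 0 < length (proj₂ s)
  ∈-reps s∈ = ∈-filter⁻ 0<length? {xs = deconcatenations w} (∈-deduplicate⁻ _↭₂?_ proper s∈)

  spec : ∀ {s} → s ∈ reps → proj₁ s ++ proj₂ s ↭ w × length (proj₁ s) < length w
  spec {u , v} s∈ with ∈-reps s∈
  ... | h , l = q , subst (length u <_) (trans (sym (length-++ u)) (↭-length q)) (ℕ.m<m+n (length u) l)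
    where q = ∈-deconcatenations⁻ w h

  pairs : ∀ rs → AllPairs (λ r s → ¬ (r ↭₂ s)) (deduplicate _↭₂?_ rs)
  pairs []       = []
  pairs (r ∷ rs) = All.all-filter (¬? ∘ (r ↭₂?_)) (deduplicate _↭₂?_ rs) ∷
                   AllPairs.filter⁺ (¬? ∘ (r ↭₂?_)) (pairs rs)

  sep : ∀ {r s} → ¬ (r ↭₂ s) → Disjoint (box r) (box s)
  sep {r} {s} ≁ (t∈r , t∈s) with ∈-box⁻ {r = r} t∈r | ∈-box⁻ {r = s} t∈s
  ... | p , q | p′ , q′ = ≁ (↭-trans (↭-sym p) p′ , ↭-trans (↭-sym q) q′)

  sep₀ : ∀ {s} → s ∈ reps → Disjoint (box (w , [])) (box s)
  sep₀ {s} s∈ = sep {w , []} {s} λ (_ , q) → ℕ.<⇒≢ (proj₂ (∈-reps s∈)) (↭-length q)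

  to : ∀ {s} → s ∈ deconcatenations w → s ∈ concatMap box ((w , []) ∷ reps)
  to {u , []}    s∈ = ∈-++⁺ˡ (∈-box⁺ (subst (_↭ w) (List.++-identityʳ u) (∈-deconcatenations⁻ w s∈) , ↭-refl))
  to {u , x ∷ v} s∈ = ∈-++⁺ʳ (box (w , [])) (∈-concatMap⁺ box (Any.map (λ (p , q) → ∈-box⁺ (↭-sym p , ↭-sym q))
    (Any.deduplicate⁺ _↭₂?_ {P = _↭₂ (u , x ∷ v)}
      (λ (p , q) (p′ , q′) → ↭-trans p p′ , ↭-trans q q′)
      (Any.map (λ { refl → ↭-refl , ↭-refl }) (∈-filter⁺ 0<length? s∈ (s≤s z≤n))))))

  from : ∀ {s} → s ∈ concatMap box ((w , []) ∷ reps) → s ∈ deconcatenations w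
  from {u , v} s∈ with ∈-concatMap-elim box ((w , []) ∷ reps) s∈
  ... | r , here refl , s∈r with ∈-box⁻ {r = w , []} s∈r
  ...   | p , q = ∈-deconcatenations⁺ u v (↭-trans (++⁺ p q) (↭-reflexive (List.++-identityʳ w)))
  from {u , v} s∈ | r , there r∈ , s∈r with ∈-box⁻ {r = r} s∈r
  ...   | p , q = ∈-deconcatenations⁺ u v (↭-trans (++⁺ p q) (proj₁ (spec r∈)))

-- Parkization as a relabelling of the letters

#≤-map : ∀ {f : ℕ → ℕ} {a b} w → All (λ x → (f x ≤ a → x ≤ b) × (x ≤ b → f x ≤ a)) w →
         #≤ a (map f w) ≡ #≤ b w
#≤-map []      []               = refl
#≤-map {f} {a} {b} (x ∷ w) ((to , from) ∷ h) with f x ≤ᵇ a | x ≤ᵇ b | ℕ.≤ᵇ-reflects-≤ (f x) a | ℕ.≤ᵇ-reflects-≤ x b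
... | true  | true  | _       | _       = cong suc (#≤-map w h)
... | true  | false | ofʸ p   | ofⁿ ¬q  = contradiction (to p) ¬q
... | false | true  | ofⁿ ¬p  | ofʸ q   = contradiction (from q) ¬p
... | false | false | _       | _       = #≤-map w h

#≤-strict : ∀ {a b x w} → x ∈ w → a < x → x ≤ b → #≤ a w < #≤ b w
#≤-strict {a} {b} {x} {_ ∷ w} (here refl) a<x x≤b with x ≤ᵇ a | x ≤ᵇ b | ℕ.≤ᵇ-reflects-≤ x a | ℕ.≤ᵇ-reflects-≤ x b
... | true  | _     | ofʸ x≤a | _       = contradiction (≤-trans a<x x≤a) ℕ.1+n≰n
... | false | true  | _       | _       = s≤s (#≤-mono w (≤-trans (ℕ.<⇒≤ a<x) x≤b))
... | false | false | _       | ofⁿ x≰b = contradiction x≤b x≰b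
#≤-strict {a} {b} {x} {y ∷ w} (there x∈w) a<x x≤b with y ≤ᵇ a | y ≤ᵇ b | ℕ.≤ᵇ-reflects-≤ y a | ℕ.≤ᵇ-reflects-≤ y b
... | true  | true  | _       | _       = s≤s (#≤-strict x∈w a<x x≤b)
... | true  | false | ofʸ y≤a | ofⁿ y≰b = contradiction (≤-trans y≤a (≤-trans (ℕ.<⇒≤ a<x) x≤b)) y≰b
... | false | true  | _       | _       = ℕ.m<n⇒m<1+n (#≤-strict x∈w a<x x≤b)
... | false | false | _       | _       = #≤-strict x∈w a<x x≤b

-- For a parking function w and b ≤ |w| this means #≤ b w ≡ b, i.e. b ends a prime
-- factor; unlike that equation it passes to subwords and is stable under parkization.
GoodCut : ℕ → List ℕ → Set
GoodCut b w = ∀ a → a ≤ b → #≤ b w + a ≤ #≤ a w + b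

GoodCut-↭ : ∀ {b v w} → v ↭ w → GoodCut b v → GoodCut b w
GoodCut-↭ {b} p g a a≤b = subst₂ (λ m n → m + a ≤ n + b) (#≤-↭ b p) (#≤-↭ a p) (g a a≤b)

-- The letters of `w` contribute `#≤ b w` on one side and only `#≤ a w ≤ #≤ b w` on the other, so
-- removing them preserves the inequality.
GoodCut-++ˡ : ∀ {b} v w → GoodCut b (v ++ w) → GoodCut b v
GoodCut-++ˡ {b} v w g a a≤b = ℕ.+-cancelʳ-≤ (#≤ b w) _ _ (begin
  #≤ b v + a + #≤ b w        ≡⟨ ℕ.+-assoc (#≤ b v) a _ ⟩
  #≤ b v + (a + #≤ b w)      ≡⟨ cong (#≤ b v +_) (ℕ.+-comm a _) ⟩
  #≤ b v + (#≤ b w + a)      ≡⟨ ℕ.+-assoc (#≤ b v) _ a ⟨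
  #≤ b v + #≤ b w + a        ≡⟨ cong (_+ a) (#≤-++ b v w) ⟨
  #≤ b (v ++ w) + a          ≤⟨ g a a≤b ⟩
  #≤ a (v ++ w) + b          ≡⟨ cong (_+ b) (#≤-++ a v w) ⟩
  #≤ a v + #≤ a w + b        ≡⟨ ℕ.+-assoc (#≤ a v) _ b ⟩
  #≤ a v + (#≤ a w + b)      ≡⟨ cong (#≤ a v +_) (ℕ.+-comm _ b) ⟩
  #≤ a v + (b + #≤ a w)      ≡⟨ ℕ.+-assoc (#≤ a v) b _ ⟨
  #≤ a v + b + #≤ a w        ≤⟨ ℕ.+-monoʳ-≤ (#≤ a v + b) (#≤-mono w a≤b) ⟩
  #≤ a v + b + #≤ b w        ∎)
  where open ℕ.≤-Reasoning

-- Monotonicity is restricted to the letters of `w`, since lowering at `e` sends both `e` and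
-- `e + 1` to `e`. In `cut`, the image `b′` need not be `f b`, as `b` need not be a letter; what
-- matters is that it separates the same letters.
record IsRelabelling (f : ℕ → ℕ) (w : List ℕ) : Set where
  field
    mono : ∀ {x y} → x ∈ w → y ∈ w → x < y → f x < f y
    cut  : ∀ {b} → GoodCut b w → ∃ λ b′ → GoodCut b′ (map f w) ×
           (∀ {x} → x ∈ w → x ≤ b → f x ≤ b′) × (∀ {x} → x ∈ w → b < x → b′ < f x)

  reflects-≤ : ∀ {x y} → x ∈ w → y ∈ w → f x ≤ f y → x ≤ y
  reflects-≤ x∈w y∈w fx≤fy = ℕ.≮⇒≥ λ y<x → ℕ.<⇒≱ (mono y∈w x∈w y<x) fx≤fy

  injective : ∀ {x y} → x ∈ w → y ∈ w → f x ≡ f y → x ≡ y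
  injective x∈w y∈w eq = ℕ.≤-antisym
    (reflects-≤ x∈w y∈w (ℕ.≤-reflexive eq)) (reflects-≤ y∈w x∈w (ℕ.≤-reflexive (sym eq)))

id-isRelabelling : ∀ w → IsRelabelling id w
id-isRelabelling w = record
  { mono = λ _ _ x<y → x<y
  ; cut  = λ {b} g → b , subst (GoodCut b) (sym (map-id w)) g , (λ _ x≤b → x≤b) , (λ _ b<x → b<x)
  }

∘-isRelabelling : ∀ {f g w} → IsRelabelling f w → IsRelabelling g (map f w) → IsRelabelling (g ∘ f) w
∘-isRelabelling {f} {g} {w} F G = record
  { mono = λ x∈ y∈ x<y → G.mono (∈-map⁺ f x∈) (∈-map⁺ f y∈) (F.mono x∈ y∈ x<y)
  ; cut  = λ c → let b′ , c′ , lo , hi = F.cut c ; b″ , c″ , lo′ , hi′ = G.cut c′ in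
      b″ , subst (GoodCut b″) (sym (map-∘ w)) c″ ,
      (λ x∈ x≤b → lo′ (∈-map⁺ f x∈) (lo x∈ x≤b)) , (λ x∈ b<x → hi′ (∈-map⁺ f x∈) (hi x∈ b<x))
  }
  where
  module F = IsRelabelling F
  module G = IsRelabelling G

lower₁ : ℕ → ℕ → ℕ
lower₁ e x = if e <ᵇ x then pred x else x

lower₁-≤ : ∀ {e x} → x ≤ e → lower₁ e x ≡ x
lower₁-≤ {e} {x} x≤e with e <ᵇ x | ℕ.<ᵇ-reflects-< e x
... | true  | ofʸ e<x = contradiction (≤-trans e<x x≤e) ℕ.1+n≰n
... | false | _       = refl

lower₁-> : ∀ {e x} → e < x → lower₁ e x ≡ pred x
lower₁-> {e} {x} e<x with e <ᵇ x | ℕ.<ᵇ-reflects-< e x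
... | true  | _       = refl
... | false | ofⁿ e≮x = contradiction e<x e≮x

search-minimal : ∀ w m i j → i ≤ j → j < d.search w m i → j ≤ #≤ j w
search-minimal w zero    i j i≤j j<i = contradiction (≤-trans j<i i≤j) ℕ.1+n≰n
search-minimal w (suc m) i j i≤j j< with #≤ i w <ᵇ i | ℕ.<ᵇ-reflects-< (#≤ i w) i
... | true  | _      = contradiction (≤-trans j< i≤j) ℕ.1+n≰n
... | false | ofⁿ ¬c with ℕ.m≤n⇒m<n∨m≡n i≤j
...   | inj₁ i<j  = search-minimal w m (suc i) j i<j j<
...   | inj₂ refl = ℕ.≮⇒≥ ¬c

-- One step of parkization: no letter equals e + 1, so lowering the larger letters
-- is strictly increasing on the letters of w.
module _ {e w} (deficient : #≤ (suc e) w < suc e) (minimal : ∀ j → j < suc e → j ≤ #≤ j w) where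

  private
    f : ℕ → ℕ
    f = lower₁ (suc e)

    avoids : ∀ {x} → x ∈ w → x ≢ suc e
    -- Since `#≤ (suc e) w ≤ e ≤ #≤ e w`, passing from `e` to `suc e` adds no letter.
    avoids x∈ refl = ℕ.<⇒≱ (#≤-strict x∈ ≤-refl ≤-refl)
      (≤-trans (s≤s⁻¹ deficient) (minimal e ≤-refl))

    count≥ : ∀ {a} → e ≤ a → #≤ a (map f w) ≡ #≤ (suc a) w
    count≥ {a} e≤a = #≤-map w (All.tabulate iff)
      where
      iff : ∀ {x} → x ∈ w → (f x ≤ a → x ≤ suc a) × (x ≤ suc a → f x ≤ a)
      iff {x} x∈ with ℕ.<-cmp x (suc e)
      ... | tri< x< _ _ rewrite lower₁-≤ (ℕ.<⇒≤ x<) = ℕ.m≤n⇒m≤1+n , λ _ → ≤-trans (s≤s⁻¹ x<) e≤a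
      ... | tri≈ _ x≡ _ = contradiction x≡ (avoids x∈)
      iff {suc x} x∈ | tri> _ _ x> rewrite lower₁-> x> = s≤s , s≤s⁻¹

    count≤ : ∀ {a} → a ≤ e → #≤ a (map f w) ≡ #≤ a w
    count≤ {a} a≤e = #≤-map w (All.tabulate iff)
      where
      iff : ∀ {x} → x ∈ w → (f x ≤ a → x ≤ a) × (x ≤ a → f x ≤ a)
      iff {x} x∈ with ℕ.<-cmp x (suc e)
      ... | tri< x< _ _ rewrite lower₁-≤ (ℕ.<⇒≤ x<) = id , id
      ... | tri≈ _ x≡ _ = contradiction x≡ (avoids x∈)
      iff {suc x} x∈ | tri> _ _ x> rewrite lower₁-> x> =
        (λ x≤a → contradiction (≤-trans (s≤s⁻¹ x>) (≤-trans x≤a a≤e)) ℕ.1+n≰n) ,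
        (λ x≤a → ≤-trans (ℕ.n≤1+n x) x≤a)

  lower-isRelabelling : IsRelabelling (lower₁ (suc e)) w
  lower-isRelabelling = record { mono = mono ; cut = cut }
    where
    mono : ∀ {x y} → x ∈ w → y ∈ w → x < y → f x < f y
    mono {x} {y} x∈ y∈ x<y with ℕ.<-cmp x (suc e) | ℕ.<-cmp y (suc e)
    ... | tri≈ _ x≡ _ | _           = contradiction x≡ (avoids x∈)
    ... | _           | tri≈ _ y≡ _ = contradiction y≡ (avoids y∈)
    ... | tri< x< _ _ | tri< y< _ _ rewrite lower₁-≤ (ℕ.<⇒≤ x<) | lower₁-≤ (ℕ.<⇒≤ y<) = x<y
    mono {x} {suc y} x∈ y∈ x<y | tri< x< _ _ | tri> _ _ y> rewrite lower₁-≤ (ℕ.<⇒≤ x<) | lower₁-> y> =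
      ≤-trans x< (s≤s⁻¹ y>)
    ... | tri> _ _ x> | tri< y< _ _ = contradiction (≤-trans x> (≤-trans (ℕ.<⇒≤ x<y) (ℕ.<⇒≤ y<))) ℕ.1+n≰n
    mono {suc x} {suc y} x∈ y∈ x<y | tri> _ _ x> | tri> _ _ y> rewrite lower₁-> x> | lower₁-> y> = s≤s⁻¹ x<y

    cut : ∀ {b} → GoodCut b w → ∃ λ b′ → GoodCut b′ (map f w) ×
          (∀ {x} → x ∈ w → x ≤ b → f x ≤ b′) × (∀ {x} → x ∈ w → b < x → b′ < f x)
    cut {b} g with b ≤? e
    -- A cut below the deficient value `suc e` stays where it is; one at or above it moves down by
    -- one together with the letters.
    ... | yes b≤e = b , good , lo , hi
      where
      good : GoodCut b (map f w)
      good a a≤b rewrite count≤ b≤e | count≤ (≤-trans a≤b b≤e) = g a a≤b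
      lo : ∀ {x} → x ∈ w → x ≤ b → f x ≤ b
      lo x∈ x≤b rewrite lower₁-≤ (≤-trans x≤b (ℕ.m≤n⇒m≤1+n b≤e)) = x≤b
      hi : ∀ {x} → x ∈ w → b < x → b < f x
      hi {x} x∈ b<x with ℕ.<-cmp x (suc e)
      ... | tri< x< _ _ rewrite lower₁-≤ (ℕ.<⇒≤ x<) = b<x
      ... | tri≈ _ x≡ _ = contradiction x≡ (avoids x∈)
      hi {suc x} x∈ b<x | tri> _ _ x> rewrite lower₁-> x> = ≤-trans (s≤s b≤e) (s≤s⁻¹ x>)
    cut {zero}  g | no b≰e = contradiction z≤n b≰e
    cut {suc b} g | no b≰e = b , good , lo , hi
      where
      e≤b : e ≤ b
      e≤b = s≤s⁻¹ (ℕ.≰⇒> b≰e)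
      -- The excess is negative at `suc e`, hence also at the cut `suc b`, where it is minimal.
      -- After lowering, the count at `b` is therefore at most `b`, which settles the comparison
      -- with `a ≤ e`, where the excess is nonnegative.
      #≤b : #≤ (suc b) w ≤ b
      #≤b = s≤s⁻¹ (ℕ.+-cancelʳ-≤ (suc e) _ _ (≤-trans (s≤s (g (suc e) (s≤s e≤b)))
        (≤-trans (ℕ.+-monoˡ-≤ (suc b) deficient) (ℕ.≤-reflexive (ℕ.+-comm (suc e) (suc b))))))
      good : GoodCut b (map f w)
      good a a≤b with ℕ.≤-total e a
      ... | inj₁ e≤a rewrite count≥ e≤b | count≥ e≤a =
        s≤s⁻¹ (subst₂ _≤_ (ℕ.+-suc _ a) (ℕ.+-suc _ b) (g (suc a) (s≤s a≤b)))
      ... | inj₂ a≤e rewrite count≥ e≤b | count≤ a≤e =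
        ≤-trans (ℕ.+-mono-≤ #≤b (minimal a (s≤s a≤e))) (ℕ.≤-reflexive (ℕ.+-comm b _))
      lo : ∀ {x} → x ∈ w → x ≤ suc b → f x ≤ b
      lo {x} x∈ x≤b with ℕ.<-cmp x (suc e)
      ... | tri< x< _ _ rewrite lower₁-≤ (ℕ.<⇒≤ x<) = ≤-trans (s≤s⁻¹ x<) e≤b
      ... | tri≈ _ x≡ _ = contradiction x≡ (avoids x∈)
      lo {suc x} x∈ x≤b | tri> _ _ x> rewrite lower₁-> x> = s≤s⁻¹ x≤b
      hi : ∀ {x} → x ∈ w → suc b < x → b < f x
      hi {suc x} x∈ b<x rewrite lower₁-> (≤-trans (s≤s (s≤s e≤b)) b<x) = s≤s⁻¹ b<x

-- Follows a single letter through the steps of parkization, while the word only decides where each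
-- step lowers. Keeping the two apart allows one relabelling to be applied to all rearrangements of
-- the word.
parkMap : ℕ → List ℕ → ℕ → ℕ
parkMap zero    w x = x
parkMap (suc m) w x =
  if d w ≡ᵇ suc (length w) then x else parkMap m (lower (d w) w) (lower₁ (d w) x)

parkSteps≡map : ∀ m w → parkSteps m w ≡ map (parkMap m w) w
parkSteps≡map zero    w = sym (map-id w)
parkSteps≡map (suc m) w with d w ≡ᵇ suc (length w)
... | true  = sym (map-id w)
... | false = trans (parkSteps≡map m (lower (d w) w)) (sym (map-∘ w))

search-↭ : ∀ {v w} → v ↭ w → ∀ m i → d.search v m i ≡ d.search w m i
search-↭ p zero    i = refl
search-↭ p (suc m) i rewrite #≤-↭ i p | search-↭ p m (suc i) = refl

parkMap-↭ : ∀ m {v w} → v ↭ w → ∀ x → parkMap m v x ≡ parkMap m w x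
parkMap-↭ zero            p x = refl
parkMap-↭ (suc m) {v} {w} p x rewrite ↭-length p | search-↭ p (length w) 1
  with d w ≡ᵇ suc (length w)
... | true  = refl
... | false = parkMap-↭ m (↭-map⁺ (lower₁ (d w)) p) (lower₁ (d w) x)

parkMap-isRelabelling : ∀ m w → IsRelabelling (parkMap m w) w
parkMap-isRelabelling zero    w = id-isRelabelling w
parkMap-isRelabelling (suc m) w
  with d w | d w ≡ᵇ suc (length w) | ≡ᵇ-reflects (d w) (suc (length w))
     | search-spec w (length w) 1 | search-minimal w (length w) 1
... | _     | true  | _     | _                  | _   = id-isRelabelling w
... | _     | false | ofⁿ ≢ | inj₁ (eq , _)      | _   = contradiction (trans eq (ℕ.+-comm _ 1)) ≢
... | suc e | false | _     | inj₂ (_ , def , _) | min =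
  ∘-isRelabelling (lower-isRelabelling def minimal) (parkMap-isRelabelling m (lower (suc e) w))
  where
  minimal : ∀ j → j < suc e → j ≤ #≤ j w
  -- The search for the deficient value starts at 1, so 0 is treated apart.
  minimal zero    _  = z≤n
  minimal (suc j) j< = min (suc j) (s≤s z≤n) j<

parkLetter : CWord → ℕ → ℕ
parkLetter w = parkMap (sum (letters w)) (letters w)

parkLetter-isRelabelling : ∀ w → IsRelabelling (parkLetter w) (letters w)
parkLetter-isRelabelling w = parkMap-isRelabelling (sum (letters w)) (letters w)

zip-map : ∀ (f : ℕ → ℕ) w → zip (map f (letters w)) (colors w) ≡ map (map₁ f) w
zip-map f []      = refl
zip-map f (x ∷ w) = cong (_ ∷_) (zip-map f w)

letters-map₁ : ∀ (f : ℕ → ℕ) w → letters (map (map₁ f) w) ≡ map f (letters w)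
letters-map₁ f w = trans (sym (map-∘ w)) (map-∘ w)

-- The bound on the number of steps, the stopping test and the values `d` are all invariant under
-- reordering, so the relabelling computed from `w` also serves for `u`.
parkᶜ≡map : ∀ {u w} → u ↭ w → parkᶜ u ≡ map (map₁ (parkLetter w)) u
parkᶜ≡map {u} {w} u↭w = trans (cong (λ v → zip v (colors u)) Park≡) (zip-map (parkLetter w) u)
  where
  lu↭lw : letters u ↭ letters w
  lu↭lw = ↭-map⁺ proj₁ u↭w
  Park≡ : Park (letters u) ≡ map (parkLetter w) (letters u)
  Park≡ = trans (parkSteps≡map (sum (letters u)) (letters u))
    (map-cong (λ x → trans (cong (λ m → parkMap m (letters u) x) (sum-↭ lu↭lw))
                           (parkMap-↭ (sum (letters w)) lu↭lw x)) (letters u))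

-- Signed words: subwords, relabellings, shifted concatenations

letters-paint : ∀ (c : Color) v → letters (map (_, c) v) ≡ v
letters-paint c v = trans (sym (map-∘ v)) (map-id v)

-- For parking functions this characterizes the rearrangements of the words π.
Signed : CWord → Set
Signed w = ∀ {x y c c′} → (x , c) ∈ w → (y , c′) ∈ w → x ≤ y →
           (∀ b → x ≤ b → b < y → ¬ GoodCut b (letters w)) → c ≡ c′

Signed-↭ : ∀ {v w} → v ↭ w → Signed v → Signed w
Signed-↭ v↭w s p q x≤y h = s (∈-resp-↭ (↭-sym v↭w) p) (∈-resp-↭ (↭-sym v↭w) q) x≤y
  λ b x≤b b<y g → h b x≤b b<y (GoodCut-↭ (↭-map⁺ proj₁ v↭w) g)

-- Every cut of `v ++ w` is a cut of `v`, so letters with no cut between them in `v` have none in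
-- the whole word either.
Signed-++ˡ : ∀ v w → Signed (v ++ w) → Signed v
Signed-++ˡ v w s p q x≤y h = s (∈-++⁺ˡ p) (∈-++⁺ˡ q) x≤y λ b x≤b b<y g →
  h b x≤b b<y (GoodCut-++ˡ (letters v) (letters w) (subst (GoodCut b) (map-++ proj₁ v w) g))

-- Used contrapositively: a cut between two letters of `w` would be carried to a cut between their
-- images.
Signed-relabel : ∀ {f} w → IsRelabelling f (letters w) → Signed w → Signed (map (map₁ f) w)
Signed-relabel {f} w F s p q x≤y h with ∈-map⁻ (map₁ f) p | ∈-map⁻ (map₁ f) q
... | (x , c) , p′ , refl | (y , c′) , q′ , refl = s p′ q′ (reflects-≤ x∈ y∈ x≤y) λ b x≤b b<y g →
    let b′ , g′ , lo , hi = cut g in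
    h b′ (lo x∈ x≤b) (hi y∈ b<y) (subst (GoodCut b′) (sym (letters-map₁ f w)) g′)
  where
  open IsRelabelling F
  x∈ : x ∈ letters w
  x∈ = ∈-map⁺ proj₁ p′
  y∈ : y ∈ letters w
  y∈ = ∈-map⁺ proj₁ q′

#≤-none : ∀ {b} w → All (b <_) w → #≤ b w ≡ 0
#≤-none []      []       = refl
#≤-none {b} (x ∷ w) (b<x ∷ h) with x ≤ᵇ b | ℕ.≤ᵇ-reflects-≤ x b
... | true  | ofʸ x≤b = contradiction (≤-trans b<x x≤b) ℕ.1+n≰n
... | false | _       = #≤-none w h

IsParking⇒≤length : ∀ {w} → IsParking w → All (_≤ length w) w
IsParking⇒≤length = All.map proj₂ ∘ proj₁

#≤-•ˡ : ∀ {b v w} → All (1 ≤_) w → b ≤ length v → #≤ b (v • w) ≡ #≤ b v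
#≤-•ˡ {b} {v} {w} pos b≤ = trans (#≤-++ b v (map (length v +_) w))
  (trans (cong (#≤ b v +_) (#≤-none _ (All.map⁺ (All.map (λ 1≤x → ℕ.≤-<-trans b≤ (ℕ.m<m+n _ 1≤x)) pos)))) (ℕ.+-identityʳ _))

#≤-•ʳ : ∀ {b v} w → All (_≤ length v) v → #≤ (length v + b) (v • w) ≡ length v + #≤ b w
#≤-•ʳ {b} {v} w v≤ = trans (#≤-++ (length v + b) v (map (length v +_) w))
  (cong₂ _+_ (#≤-all _ (All.map (λ x≤ → ≤-trans x≤ (ℕ.m≤m+n _ b)) v≤)) (#≤-shift (length v) b w))

#≤-0 : ∀ {w} → IsParking w → #≤ 0 w ≡ 0
#≤-0 = #≤-none _ ∘ IsParking⇒positive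

#≤-length≡ : ∀ {w} → IsParking w → #≤ (length w) w ≡ length w
#≤-length≡ = #≤-all _ ∘ IsParking⇒≤length

-- Comparison with `a = 0`, where a parking function has no letters, gives `#≤ b w ≤ b`; the parking
-- condition gives the other inequality.
GoodCut⇒≡ : ∀ {b w} → IsParking w → b ≤ length w → GoodCut b w → #≤ b w ≡ b
GoodCut⇒≡ {b} {w} pw b≤ g = ℕ.≤-antisym
  (subst₂ _≤_ (ℕ.+-identityʳ _) (cong (_+ b) (#≤-0 pw)) (g 0 z≤n)) (IsParking⇒#≤ pw b b≤)

≡⇒GoodCut : ∀ {b w} → IsParking w → b ≤ length w → #≤ b w ≡ b → GoodCut b w
≡⇒GoodCut {b} {w} pw b≤ eq a a≤b = subst (λ m → m + a ≤ #≤ a w + b) (sym eq)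
  (≤-trans (ℕ.≤-reflexive (ℕ.+-comm b a)) (ℕ.+-monoˡ-≤ b (IsParking⇒#≤ pw a (≤-trans a≤b b≤))))

length-• : ∀ v w → length (v • w) ≡ length v + length w
length-• v w = trans (length-++ v) (cong (length v +_) (length-map _ w))

GoodCut-• : ∀ {b v w} → IsParking v → IsParking w → GoodCut b w → GoodCut (length v + b) (v • w)
GoodCut-• {b} {v} {w} pv pw g a a≤ rewrite #≤-•ʳ {b} {v} w (IsParking⇒≤length pv) with ℕ.≤-total a (length v)
-- The excess of `v • w` at `length v + b` is that of `w` at `b`, which is at most 0 by comparison
-- with 0, whereas at `a` the excess of a parking function is nonnegative.
... | inj₁ a≤k = begin
  length v + #≤ b w + a            ≤⟨ ℕ.+-monoˡ-≤ a (ℕ.+-monoʳ-≤ (length v) #≤b) ⟩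
  length v + b + a                 ≡⟨ ℕ.+-comm _ a ⟩
  a + (length v + b)               ≤⟨ ℕ.+-monoˡ-≤ _ (IsParking⇒#≤ (IsParking-• pv pw) a
                                        (≤-trans a≤k (subst (length v ≤_) (sym (length-• v w)) (ℕ.m≤m+n _ _)))) ⟩
  #≤ a (v • w) + (length v + b)    ∎
  where
  open ℕ.≤-Reasoning
  #≤b : #≤ b w ≤ b
  #≤b = subst₂ _≤_ (ℕ.+-identityʳ _) (cong (_+ b) (#≤-0 pw)) (g 0 z≤n)
... | inj₂ k≤a with ℕ.m≤n⇒∃[o]m+o≡n k≤a
... | a′ , refl rewrite #≤-•ʳ {a′} {v} w (IsParking⇒≤length pv) = begin
  length v + #≤ b w + (length v + a′)     ≡⟨ interchange (length v) _ _ _ ⟩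
  length v + length v + (#≤ b w + a′)     ≤⟨ ℕ.+-monoʳ-≤ (length v + length v) (g a′ (ℕ.+-cancelˡ-≤ (length v) a′ b a≤)) ⟩
  length v + length v + (#≤ a′ w + b)     ≡⟨ interchange (length v) _ _ _ ⟩
  length v + #≤ a′ w + (length v + b)     ∎
  where
  open ℕ.≤-Reasoning

-- The value `length v` is a cut separating the letters of `v` from the shifted ones, so colours are
-- compared only inside `v`, which has a single colour, or inside `w`, whose cuts are shifted along.
Signed-•ᶜ : ∀ (v : List ℕ) c w → IsParking v → IsParking (letters w) → Signed w → Signed (map (_, c) v •ᶜ w)
Signed-•ᶜ v c w pv pw s {x} {y} p q x≤y h
  with ∈-++⁻ (map (_, c) v) p | ∈-++⁻ (map (_, c) v) q
... | inj₁ p′ | inj₁ q′ with ∈-map⁻ (_, c) p′ | ∈-map⁻ (_, c) q′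
...   | _ , _ , refl | _ , _ , refl = refl
Signed-•ᶜ v c w pv pw s {x} {y} p q x≤y h
  | inj₁ p′ | inj₂ q′ with ∈-map⁻ (_, c) p′ | ∈-map⁻ (map₁ (length (map (_, c) v) +_)) q′
...   | _ , x∈ , refl | (y′ , _) , y∈ , refl = contradiction good (h (length v) (All.lookup (IsParking⇒≤length pv) x∈) k<y)
  where
  k<y : length v < length (map (_, c) v) + y′
  k<y = subst (λ k → length v < k + y′) (sym (length-map (_, c) v))
    (ℕ.m<m+n _ (All.lookup (IsParking⇒positive pw) (∈-map⁺ proj₁ y∈)))
  good : GoodCut (length v) (letters (map (_, c) v •ᶜ w))
  good = subst (GoodCut (length v))
    (sym (trans (letters-•ᶜ (map (_, c) v) w) (cong (_• letters w) (letters-paint c v))))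
    (≡⇒GoodCut (IsParking-• pv pw) (subst (length v ≤_) (sym (length-• v (letters w))) (ℕ.m≤m+n _ _))
      (trans (#≤-•ˡ {v = v} (IsParking⇒positive pw) ≤-refl) (#≤-length≡ pv)))
Signed-•ᶜ v c w pv pw s {x} {y} p q x≤y h
  | inj₂ p′ | inj₁ q′ with ∈-map⁻ (map₁ (length (map (_, c) v) +_)) p′ | ∈-map⁻ (_, c) q′
...   | (x′ , _) , x∈ , refl | _ , y∈ , refl = contradiction
  (≤-trans x≤y (subst (y ≤_) (sym (length-map (_, c) v)) (All.lookup (IsParking⇒≤length pv) y∈)))
  (ℕ.<⇒≱ (ℕ.m<m+n _ (All.lookup (IsParking⇒positive pw) (∈-map⁺ proj₁ x∈))))
Signed-•ᶜ v c w pv pw s {x} {y} p q x≤y h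
  | inj₂ p′ | inj₂ q′ with ∈-map⁻ (map₁ (length (map (_, c) v) +_)) p′ | ∈-map⁻ (map₁ (length (map (_, c) v) +_)) q′
...   | (x′ , _) , x∈ , refl | (y′ , _) , y∈ , refl = s x∈ y∈ (ℕ.+-cancelˡ-≤ k x′ y′ x≤y)
  λ b x≤b b<y g → h (k + b) (ℕ.+-monoʳ-≤ k x≤b) (ℕ.+-monoʳ-< k b<y)
    (subst₂ (λ k u → GoodCut (k + b) u) (sym (length-map (_, c) v))
      (sym (trans (letters-•ᶜ (map (_, c) v) w) (cong (_• letters w) (letters-paint c v))))
      (GoodCut-• pv pw g))
  where k = length (map (_, c) v)

-- The words of signed nondecreasing parking functions, and their uniqueness up to rearrangement

IsParking? : Decidable IsParking
IsParking? w = All.all? (λ x → (1 ≤? x) ×-dec (x ≤? length w)) w ×-dec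
               Fin.all? (λ i → lookup (Sort.sort w) i ≤? _)

-- A refinement stores its proof irrelevantly; decidability lets `recompute` turn it into one that
-- can be used in computations. The next three lemmas proceed in the same way.
prime-isParking : ∀ (q : PrimeNDPF) → IsParking (value q)
prime-isParking (w , [ h ]) = recompute (IsParking? w) (proj₁ h)

prime-sorted : ∀ (q : PrimeNDPF) → Sorted (value q)
prime-sorted (w , [ h ]) = recompute (sorted? ℕ._≤?_ w) (proj₁ (proj₂ h))

prime-nonempty : ∀ (q : PrimeNDPF) → 1 ≤ length (value q)
prime-nonempty (w , [ h ]) = recompute (1 ≤? length w) (proj₁ (proj₂ (proj₂ h)))

prime-isPrime : ∀ (q : PrimeNDPF) b → 1 ≤ b → b ≤ length (value q) → #≤ b (value q) ≡ b → b ≡ length (value q)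
prime-isPrime (w , [ h ]) b 1≤b b≤ eq = recompute (b ℕ.≟ length w) (proj₂ (proj₂ (proj₂ h)) b 1≤b b≤ eq)

concatNDPF : List (PrimeNDPF × Color) → List ℕ
concatNDPF = foldr (λ (q , _) v → value q • v) []

concat-isParking : ∀ fs → IsParking (concatNDPF fs)
concat-isParking []             = #≤⇒IsParking [] (λ b l → l)
concat-isParking ((q , c) ∷ fs) = IsParking-• (prime-isParking q) (concat-isParking fs)

concat-sorted : ∀ fs → Sorted (concatNDPF fs)
concat-sorted []             = []
concat-sorted ((q , c) ∷ fs) = AllPairs⇒Linked (AllPairs.++⁺
  (Linked⇒AllPairs ≤-trans (prime-sorted q))
  (AllPairs.map⁺ (AllPairs.map (ℕ.+-monoʳ-≤ _) (Linked⇒AllPairs ≤-trans (concat-sorted fs))))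
  (All.map (λ x≤ → All.map⁺ (All.universal (λ y → ≤-trans x≤ (ℕ.m≤m+n _ y)) (concatNDPF fs)))
           (IsParking⇒≤length (prime-isParking q))))

fromFactors : List (PrimeNDPF × Color) → SignedNDPF
fromFactors fs = ((concatNDPF fs , [ concat-isParking fs , concat-sorted fs ]) , fs) , [ refl ]

factors : SignedNDPF → List (PrimeNDPF × Color)
factors = proj₂ ∘ value

word : SignedNDPF → CWord
word = coloredConcat ∘ factors

factors-injective : ∀ {π σ} → factors π ≡ factors σ → π ≡ σ
factors-injective {((v , pv) , fs) , [ eq ]} {((w , pw) , gs) , [ eq′ ]} refl =
  value-injective (cong (_, fs) (value-injective
    (trans (sym (recompute (concatNDPF fs ≟ v) eq)) (recompute (concatNDPF fs ≟ w) eq′))))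

coloredConcat-isParking : ∀ fs → IsParking (letters (coloredConcat fs))
coloredConcat-isParking fs = subst IsParking (sym (letters-coloredConcat fs)) (concat-isParking fs)

coloredConcat-signed : ∀ fs → Signed (coloredConcat fs)
coloredConcat-signed []             ()
coloredConcat-signed ((q , c) ∷ fs) = Signed-•ᶜ (value q) c (coloredConcat fs)
  (prime-isParking q) (coloredConcat-isParking fs) (coloredConcat-signed fs)

shiftBy-+ : ∀ k l w → shiftBy k (shiftBy l w) ≡ shiftBy (k + l) w
shiftBy-+ k l w = trans (sym (map-∘ w)) (map-cong (λ (x , c) → cong (_, c) (sym (ℕ.+-assoc k l x))) w)

•ᶜ-assoc : ∀ u v w → (u •ᶜ v) •ᶜ w ≡ u •ᶜ (v •ᶜ w)
•ᶜ-assoc u v w = trans (++-assoc u _ _) (cong (u ++_) (sym (trans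
  (map-++ _ v (shiftBy (length v) w))
  (cong (shiftBy (length u) v ++_) (trans (shiftBy-+ (length u) (length v) w)
    (cong (λ k → shiftBy k w) (sym (trans (length-++ u) (cong (length u +_) (length-map _ v))))))))))

coloredConcat-++ : ∀ fs gs → coloredConcat (fs ++ gs) ≡ coloredConcat fs •ᶜ coloredConcat gs
coloredConcat-++ []             gs = sym (trans (map-cong (λ _ → refl) _) (map-id _))
coloredConcat-++ ((q , c) ∷ fs) gs = trans (cong (map (_, c) (value q) •ᶜ_) (coloredConcat-++ fs gs))
  (sym (•ᶜ-assoc (map (_, c) (value q)) (coloredConcat fs) (coloredConcat gs)))

sorted-↭⇒≡ : ∀ {v w} → Sorted v → Sorted w → v ↭ w → v ≡ w
sorted-↭⇒≡ sv sw p = Pointwise-≡⇒≡ (↗↭↗⇒≋ ℕ.≤-totalOrder sv sw (↭⇒↭ₛ p))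

letter≤? : ∀ b → Decidable (λ (l : ℕ × Color) → proj₁ l ≤ b)
letter≤? b l = proj₁ l ≤? b

shiftBy-> : ∀ k {w} → All (1 ≤_) (letters w) → All (λ l → ¬ proj₁ l ≤ k) (shiftBy k w)
shiftBy-> k pos = All.map⁺ (All.map (λ 1≤x → ℕ.<⇒≱ (ℕ.m<m+n k 1≤x)) (All.map⁻ pos))

module _ (q q′ : PrimeNDPF) c c′ fs fs′
         (p : coloredConcat ((q , c) ∷ fs) ↭ coloredConcat ((q′ , c′) ∷ fs′)) where

  private
    lp : concatNDPF ((q , c) ∷ fs) ↭ concatNDPF ((q′ , c′) ∷ fs′)
    lp = subst₂ _↭_ (letters-coloredConcat ((q , c) ∷ fs)) (letters-coloredConcat ((q′ , c′) ∷ fs′)) (↭-map⁺ proj₁ p)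

  -- The end of the shorter first factor is visible in the multiset of letters as a `k` with exactly
  -- `k` letters at most `k`. By primality the other first factor cannot contain such a `k` properly
  -- inside.
  firstFactor-length : length (value q) ≤ length (value q′) → length (value q) ≡ length (value q′)
  firstFactor-length k≤ = prime-isPrime q′ (length (value q)) (prime-nonempty q) k≤ (begin
    #≤ k (value q′)                          ≡⟨ #≤-•ˡ {v = value q′} (IsParking⇒positive (concat-isParking fs′)) k≤ ⟨
    #≤ k (concatNDPF ((q′ , c′) ∷ fs′))      ≡⟨ #≤-↭ k lp ⟨
    #≤ k (concatNDPF ((q , c) ∷ fs))         ≡⟨ #≤-•ˡ {v = value q} (IsParking⇒positive (concat-isParking fs)) ≤-refl ⟩
    #≤ k (value q)                           ≡⟨ #≤-length≡ (prime-isParking q) ⟩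
    k                                        ∎)
    where
    open ≡.≡-Reasoning
    k = length (value q)

  -- With equal lengths, the same threshold `k` separates the first factor from the shifted rest in
  -- both words, so filtering splits the permutation in two.
  firstFactor : length (value q) ≡ length (value q′) →
                map (_, c) (value q) ↭ map (_, c′) (value q′) × coloredConcat fs ↭ coloredConcat fs′
  firstFactor k≡ =
    ↭-trans (↭-sym (proj₁ split)) (proj₁ split′) ,
    map-injective-↭ {f = map₁ (k +_)}
      (λ { {x , _} {y , _} eq → cong₂ _,_ (ℕ.+-cancelˡ-≡ k x y (cong proj₁ eq)) (cong proj₂ eq) })
      (↭-trans (↭-sym (proj₂ split)) (↭-trans (proj₂ split′)
        (↭-reflexive (cong (λ k → shiftBy k (coloredConcat fs′)) (sym len≡)))))
    where
    k = length (map (_, c) (value q))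
    len≡ : k ≡ length (map (_, c′) (value q′))
    len≡ = trans (length-map _ (value q)) (trans k≡ (sym (length-map _ (value q′))))
    ≤k : ∀ (q : PrimeNDPF) c → All (λ l → proj₁ l ≤ length (map (_, c) (value q))) (map (_, c) (value q))
    ≤k q c = All.map⁺ {f = _, c}
      (subst (λ n → All (_≤ n) (value q)) (sym (length-map _ (value q))) (IsParking⇒≤length (prime-isParking q)))
    split : filter (letter≤? k) (coloredConcat ((q , c) ∷ fs)) ↭ map (_, c) (value q) ×
            filter (¬? ∘ letter≤? k) (coloredConcat ((q , c) ∷ fs)) ↭ shiftBy k (coloredConcat fs)
    split = filter-++-↭ (letter≤? k) (≤k q c)
      (shiftBy-> k (IsParking⇒positive (coloredConcat-isParking fs))) ↭-refl
    split′ : filter (letter≤? k) (coloredConcat ((q , c) ∷ fs)) ↭ map (_, c′) (value q′) ×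
             filter (¬? ∘ letter≤? k) (coloredConcat ((q , c) ∷ fs)) ↭
               shiftBy (length (map (_, c′) (value q′))) (coloredConcat fs′)
    split′ = filter-++-↭ (letter≤? k) (subst (λ n → All (λ l → proj₁ l ≤ n) _) (sym len≡) (≤k q′ c′))
      (subst (λ n → All (λ l → ¬ proj₁ l ≤ n) (shiftBy (length (map (_, c′) (value q′))) (coloredConcat fs′))) (sym len≡)
        (shiftBy-> _ (IsParking⇒positive (coloredConcat-isParking fs′)))) p

monochromatic-↭ : ∀ {c c′ : Color} (v w : List ℕ) → 1 ≤ length v → map (_, c) v ↭ map (_, c′) w → c ≡ c′
monochromatic-↭ {c} {c′} (x ∷ v) w _ r = All.head (All-resp-↭ (↭-sym r) painted)
  where
  painted : All (λ l → proj₂ l ≡ c′) (map (_, c′) w)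
  painted = All.map⁺ {f = _, c′} (All.universal (λ _ → refl) w)

-- First factors are peeled off together: their length is determined by the multiset, a prime factor
-- by its letters because it is sorted, and its colour by any letter because it is nonempty. This
-- makes orbits disjoint and the `P π` independent.
coloredConcat-↭ : ∀ fs gs → coloredConcat fs ↭ coloredConcat gs → fs ≡ gs
coloredConcat-↭ [] [] p = refl
coloredConcat-↭ [] ((q , c) ∷ gs) p with value q | prime-nonempty q | ↭-length p
... | x ∷ w | _ | ()
coloredConcat-↭ ((q , c) ∷ fs) [] p with value q | prime-nonempty q | ↭-length p
... | x ∷ w | _ | ()
coloredConcat-↭ ((q , c) ∷ fs) ((q′ , c′) ∷ gs) p with firstFactor q q′ c c′ fs gs p k≡
  where
  k≡ : length (value q) ≡ length (value q′)
  k≡ with ℕ.≤-total (length (value q)) (length (value q′))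
  ... | inj₁ k≤ = firstFactor-length q q′ c c′ fs gs p k≤
  ... | inj₂ k≥ = sym (firstFactor-length q′ q c′ c gs fs (↭-sym p) k≥)
... | r , s = cong₂ _∷_ (cong₂ _,_ q≡ c≡) (coloredConcat-↭ fs gs s)
  where
  q≡ : q ≡ q′
  q≡ = value-injective (sorted-↭⇒≡ (prime-sorted q) (prime-sorted q′)
    (subst₂ _↭_ (letters-paint c (value q)) (letters-paint c′ (value q′)) (↭-map⁺ proj₁ r)))
  c≡ : c ≡ c′
  c≡ = monochromatic-↭ (value q) (value q′) (prime-nonempty q) r

-- Factorization into primes

least : ∀ {p} {P : Pred ℕ p} → Decidable P → ∀ m i → P (m + i) →
        ∃ λ b → i ≤ b × b ≤ m + i × P b × (∀ j → i ≤ j → j < b → ¬ P j)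
least P? zero    i p = i , ≤-refl , ≤-refl , p , λ j i≤j j<i → contradiction (≤-trans j<i i≤j) ℕ.1+n≰n
least {P = P} P? (suc m) i p with P? i
... | yes q = i , ≤-refl , ℕ.m≤n+m i (suc m) , q , λ j i≤j j<i → contradiction (≤-trans j<i i≤j) ℕ.1+n≰n
... | no ¬q with least P? m (suc i) (subst P (sym (ℕ.+-suc m i)) p)
...   | b , i<b , b≤ , q , min = b , ℕ.<⇒≤ i<b , subst (b ≤_) (ℕ.+-suc m i) b≤ , q , min′
  where
  min′ : ∀ j → i ≤ j → j < b → ¬ P j
  min′ j i≤j j<b with ℕ.m≤n⇒m<n∨m≡n i≤j
  ... | inj₁ i<j  = min j i<j j<b
  ... | inj₂ refl = ¬q

filter-split : ∀ b (w : CWord) → w ↭ filter (letter≤? b) w ++ filter (¬? ∘ letter≤? b) w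
filter-split b w = All.lookup (shuffles-↭ (filter (letter≤? b) w) (filter (¬? ∘ letter≤? b) w)) (∈-shuffles (letter≤? b) w)

record FirstFactor (w : CWord) : Set where
  field
    prime : PrimeNDPF
    color : Color
    rest  : CWord
    split : w ↭ map (_, color) (value prime) •ᶜ rest
    rest-isParking : IsParking (letters rest)
    rest-signed    : Signed rest

module _ (w : CWord) (pw : IsParking (letters w)) (sw : Signed w) (b : ℕ)
         (1≤b : 1 ≤ b) (b≤n : b ≤ length (letters w)) (#b : #≤ b (letters w) ≡ b)
         (minimal : ∀ j → 1 ≤ j → j < b → #≤ j (letters w) ≢ j) where

  private
    L U R : CWord
    -- `b` is the end of the first prime factor: `L` consists of its letters, and `R` is the
    -- remainder, shifted down to be a parking function again.
    L = filter (letter≤? b) w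
    U = filter (¬? ∘ letter≤? b) w
    R = map (map₁ (_∸ b)) U

    L≤b : All (_≤ b) (letters L)
    L≤b = All.map⁺ (All.all-filter (letter≤? b) w)
    U>b : All (λ l → b < proj₁ l) U
    U>b = All.map ℕ.≰⇒> (All.all-filter (¬? ∘ letter≤? b) w)

    shift-R : shiftBy b R ≡ U
    shift-R = trans (sym (map-∘ U))
      (map-id-local (All.map (λ {l} b<x → cong (_, proj₂ l) (ℕ.m+[n∸m]≡n (ℕ.<⇒≤ b<x))) U>b))

    w↭ : w ↭ L ++ shiftBy b R
    w↭ = subst (λ v → w ↭ L ++ v) (sym shift-R) (filter-split b w)

    lw↭ : letters w ↭ letters L ++ map (b +_) (letters R)
    lw↭ = ↭-trans (↭-map⁺ proj₁ w↭) (↭-reflexive (trans (map-++ proj₁ L (shiftBy b R))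
      (cong (letters L ++_) (letters-map₁ (b +_) R))))

    positive : All (1 ≤_) (letters L ++ map (b +_) (letters R))
    positive = All-resp-↭ lw↭ (IsParking⇒positive pw)

    R-positive : All (1 ≤_) (letters R)
    R-positive = All.map⁺ (All.map⁺ (All.map ℕ.m<n⇒0<n∸m U>b))

    #L : ∀ {a} → a ≤ b → #≤ a (letters L) ≡ #≤ a (letters w)
    #L {a} a≤b = sym (trans (#≤-↭ a lw↭) (trans (#≤-++ a (letters L) _) (trans
      (cong (#≤ a (letters L) +_) (#≤-none _ (All.map⁺ (All.map (λ 1≤x → ℕ.≤-<-trans a≤b (ℕ.m<m+n b 1≤x)) R-positive))))
      (ℕ.+-identityʳ _))))

    |L| : length (letters L) ≡ b
    |L| = trans (sym (#≤-all b L≤b)) (trans (#L ≤-refl) #b)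

    #R : ∀ a → #≤ (b + a) (letters w) ≡ b + #≤ a (letters R)
    #R a = trans (#≤-↭ (b + a) lw↭) (trans (#≤-++ (b + a) (letters L) _)
      (cong₂ _+_ (trans (#≤-all (b + a) (All.map (λ x≤b → ≤-trans x≤b (ℕ.m≤m+n b a)) L≤b)) |L|)
                 (#≤-shift b a (letters R))))

    L-isParking : IsParking (letters L)
    L-isParking = #≤⇒IsParking (All.++⁻ˡ (letters L) positive) λ j j≤ →
      let j≤b = subst (j ≤_) |L| j≤ in
      subst (j ≤_) (sym (#L j≤b)) (IsParking⇒#≤ pw j (≤-trans j≤b b≤n))

    n≡ : length (letters w) ≡ b + length (letters R)
    n≡ = trans (↭-length lw↭) (trans (length-++ (letters L)) (cong₂ _+_ |L| (length-map _ (letters R))))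

    R-isParking : IsParking (letters R)
    R-isParking = #≤⇒IsParking R-positive λ j j≤ → ℕ.+-cancelˡ-≤ b _ _
      (subst (b + j ≤_) (#R j) (IsParking⇒#≤ pw (b + j) (subst (b + j ≤_) (sym n≡) (ℕ.+-monoʳ-≤ b j≤))))

    sort↭ : Sort.sort (letters L) ↭ letters L
    sort↭ = Sort.sort-↭ (letters L)

    |sort| : length (Sort.sort (letters L)) ≡ b
    |sort| = trans (↭-length sort↭) |L|

    nonempty : 1 ≤ length (Sort.sort (letters L))
    nonempty = subst (1 ≤_) (sym |sort|) 1≤b

    prime : ∀ j → 1 ≤ j → j ≤ length (Sort.sort (letters L)) → #≤ j (Sort.sort (letters L)) ≡ j →
            j ≡ length (Sort.sort (letters L))
    prime j 1≤j j≤ eq with ℕ.m≤n⇒m<n∨m≡n (subst (j ≤_) |sort| j≤)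
    ... | inj₁ j<b = contradiction (trans (sym (#L (ℕ.<⇒≤ j<b))) (trans (sym (#≤-↭ j sort↭)) eq)) (minimal j 1≤j j<b)
    ... | inj₂ j≡b = trans j≡b (sym |sort|)

    -- A cut between two letters of `L` would be a positive `j < b` with `#≤ j (letters w) ≡ j`,
    -- against the choice of `b`. Hence `Signed` forces one colour on `L`.
    uncut : ∀ {x y c c′} → (x , c) ∈ L → (y , c′) ∈ L → ∀ j → x ≤ j → j < y → ¬ GoodCut j (letters w)
    uncut x∈ y∈ j x≤j j<y g = minimal j
      (≤-trans (All.lookup (IsParking⇒positive L-isParking) (∈-map⁺ proj₁ x∈)) x≤j) j<b
      (GoodCut⇒≡ pw (≤-trans (ℕ.<⇒≤ j<b) b≤n) g)
      where
      j<b : j < b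
      j<b = ≤-trans j<y (All.lookup L≤b (∈-map⁺ proj₁ y∈))

    monochromatic : ∀ {x y c c′} → (x , c) ∈ L → (y , c′) ∈ L → c ≡ c′
    monochromatic {x} {y} x∈ y∈ with ℕ.≤-total x y
    ... | inj₁ x≤y = sw (proj₁ (∈-filter⁻ (letter≤? b) x∈)) (proj₁ (∈-filter⁻ (letter≤? b) y∈)) x≤y (uncut x∈ y∈)
    ... | inj₂ y≤x = sym (sw (proj₁ (∈-filter⁻ (letter≤? b) y∈)) (proj₁ (∈-filter⁻ (letter≤? b) x∈)) y≤x (uncut y∈ x∈))

    nonempty⇒∈ : ∀ {v : CWord} → 1 ≤ length v → ∃ λ l → l ∈ v
    nonempty⇒∈ {l ∷ v} _ = l , here refl

    letter₀ : ∃ λ l → l ∈ L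
    letter₀ = nonempty⇒∈ (subst (1 ≤_) (trans (sym |L|) (length-map proj₁ L)) 1≤b)

    color₀ : Color
    color₀ = proj₂ (proj₁ letter₀)

    paint-L : map (_, color₀) (letters L) ≡ L
    paint-L = trans (sym (map-∘ L))
      (map-id-local (All.tabulate (λ l∈ → cong (_ ,_) (monochromatic (proj₂ letter₀) l∈))))

    split : w ↭ map (_, color₀) (Sort.sort (letters L)) •ᶜ R
    split = ↭-trans w↭ (++⁺
      (↭-trans (↭-reflexive (sym paint-L)) (↭-map⁺ (_, color₀) (↭-sym sort↭)))
      (↭-reflexive (cong (λ k → shiftBy k R) (sym (trans (length-map _ (Sort.sort (letters L))) |sort|)))))

    R-signed : Signed R
    R-signed {x} {y} p q x≤y h with ∈-map⁻ (map₁ (_∸ b)) p | ∈-map⁻ (map₁ (_∸ b)) q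
    ... | (x′ , c) , p′ , refl | (y′ , c′) , q′ , refl =
      sw (proj₁ (∈-filter⁻ (¬? ∘ letter≤? b) p′)) (proj₁ (∈-filter⁻ (¬? ∘ letter≤? b) q′)) (unshift x≤y) cuts′
      where
      x≡ : b + x ≡ x′
      x≡ = ℕ.m+[n∸m]≡n (ℕ.<⇒≤ (All.lookup U>b p′))
      y≡ : b + y ≡ y′
      y≡ = ℕ.m+[n∸m]≡n (ℕ.<⇒≤ (All.lookup U>b q′))
      unshift : x ≤ y → x′ ≤ y′
      unshift x≤y = subst₂ _≤_ x≡ y≡ (ℕ.+-monoʳ-≤ b x≤y)
      cuts′ : ∀ j → x′ ≤ j → j < y′ → ¬ GoodCut j (letters w)
      cuts′ j x′≤j j<y′ g with ℕ.m≤n⇒∃[o]m+o≡n (≤-trans (ℕ.<⇒≤ (All.lookup U>b p′)) x′≤j)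
      -- A cut `b + i` of `w` gives the cut `i` of `R`. Both the counts and the bounds exceed those
      -- of `R` by `b`, which is why `b + b` is cancelled.
      ... | i , refl = h i
        (ℕ.+-cancelˡ-≤ b x i (subst (_≤ b + i) (sym x≡) x′≤j))
        (ℕ.+-cancelˡ-< b i y (subst (b + i <_) (sym y≡) j<y′))
        (λ a a≤i → ℕ.+-cancelˡ-≤ (b + b) _ _ (subst₂ _≤_
          (trans (cong (_+ (b + a)) (#R i)) (interchange b (#≤ i (letters R)) b a))
          (trans (cong (_+ (b + i)) (#R a)) (interchange b (#≤ a (letters R)) b i))
          (g (b + a) (ℕ.+-monoʳ-≤ b a≤i))))

  splitAtCut : FirstFactor w
  splitAtCut = record
    { prime          = Sort.sort (letters L) ,
                       [ IsParking-↭ (↭-sym sort↭) L-isParking , Sort.sort-↗ (letters L) , nonempty , prime ]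
    ; color          = color₀
    ; rest           = R
    ; split          = split
    ; rest-isParking = R-isParking
    ; rest-signed    = R-signed
    }

firstFactorOf : ∀ w → 1 ≤ length w → IsParking (letters w) → Signed w → FirstFactor w
firstFactorOf w 1≤n pw sw
  with n≡ ← ℕ.m∸n+n≡m (subst (1 ≤_) (sym (length-map proj₁ w)) 1≤n)
  -- The search runs from 1 to the length, where it succeeds at the latest because no letter of a
  -- parking function exceeds the length.
  with least (λ b → #≤ b (letters w) ℕ.≟ b) (length (letters w) ∸ 1) 1
         (subst (λ m → #≤ m (letters w) ≡ m) (sym n≡) (#≤-length≡ pw))
... | b , 1≤b , b≤n , #b , minimal = splitAtCut w pw sw b 1≤b (subst (b ≤_) n≡ b≤n) #b minimal

factor : ∀ n w → length w ≤ n → IsParking (letters w) → Signed w → ∃ λ fs → coloredConcat fs ↭ w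
factor n       []      _   pw sw = [] , ↭-refl
factor (suc n) (x ∷ w) |w| pw sw =
  (prime , color) ∷ proj₁ tail ,
  ↭-trans (++⁺ ↭-refl (↭-map⁺ _ (proj₂ tail))) (↭-sym split)
  where
  open FirstFactor (firstFactorOf (x ∷ w) (s≤s z≤n) pw sw)
  shorter : length rest < length (x ∷ w)
  shorter = subst (length rest <_)
    (sym (trans (↭-length split) (trans (length-++ (map (_, color) (value prime)))
      (cong₂ _+_ (length-map _ (value prime)) (length-map _ rest)))))
    (ℕ.m<n+m (length rest) (prime-nonempty prime))
  tail : ∃ λ fs → coloredConcat fs ↭ rest
  tail = factor n rest (s≤s⁻¹ (≤-trans shorter |w|)) rest-isParking rest-signed

-- Turns the local criterion `Signed` into an actual index `π`, so that parkized halves of a word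
-- can be recognized as members of orbits.
signedNDPF : ∀ w → IsParking (letters w) → Signed w → ∃ λ π → word π ↭ w
signedNDPF w pw sw = let fs , p = factor (length w) w ≤-refl pw sw in fromFactors fs , p

-- Orbits

value-refineAll : ∀ {p} {P : A → Set p} xs (h : Irrelevant (All P xs)) → map value (refineAll xs h) ≡ xs
value-refineAll []       h = refl
value-refineAll (x ∷ xs) h = cong (x ∷_) (value-refineAll xs _)

value-orbit : ∀ π → map value (orbit π) ≡ rearrangements (word π)
value-orbit π = value-refineAll (rearrangements (word π)) _

value-⋓ : ∀ v w → map value (v ⋓ w) ≡ shiftedShuffles (value v) (value w)
value-⋓ v w = value-refineAll (shiftedShuffles (value v) (value w)) _

map-concatMap-map : ∀ {c d} {C : Set c} {D : Set d} {f : A → List B} {f′ : C → List D} {g : A → C} {h : B → D} →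
                    (∀ x → map h (f x) ≡ f′ (g x)) → ∀ xs → map h (concatMap f xs) ≡ concatMap f′ (map g xs)
map-concatMap-map {f = f} {f′} {g} {h} e xs = trans (map-concatMap h f xs)
  (trans (concatMap-cong e xs) (sym (concatMap-map f′ g xs)))

cartesianProduct-↭ : ∀ {xs xs′ : List A} {ys ys′ : List B} → xs ↭ xs′ → ys ↭ ys′ →
                     cartesianProduct xs ys ↭ cartesianProduct xs′ ys′
cartesianProduct-↭ {A = A} {B = B} {xs′ = xs′} {ys = ys} p q = ↭-trans (left p) (right xs′ q)
  where
  left : ∀ {xs xs′} → xs ↭ xs′ → cartesianProduct xs ys ↭ cartesianProduct xs′ ys
  left Perm.refl          = ↭-refl
  left (Perm.prep x p)    = ++⁺ˡ (map (x ,_) ys) (left p)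
  left (Perm.swap x y p)  = ↭-trans (shifts (map (x ,_) ys) (map (y ,_) ys))
    (++⁺ˡ (map (y ,_) ys) (++⁺ˡ (map (x ,_) ys) (left p)))
  left (Perm.trans p₁ p₂) = ↭-trans (left p₁) (left p₂)
  right : ∀ (xs : List A) {ys ys′ : List B} → ys ↭ ys′ → cartesianProduct xs ys ↭ cartesianProduct xs ys′
  right []       q = ↭-refl
  right (x ∷ xs) q = ++⁺ (↭-map⁺ (x ,_) q) (right xs q)

map-cartesianProduct : ∀ {c d} {C : Set c} {D : Set d} (f : A → C) (g : B → D) xs ys →
                       map (Product.map f g) (cartesianProduct xs ys) ≡ cartesianProduct (map f xs) (map g ys)
map-cartesianProduct f g []       ys = refl
map-cartesianProduct f g (x ∷ xs) ys = trans (map-++ _ (map (x ,_) ys) _)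
  (cong₂ _++_ (trans (sym (map-∘ ys)) (map-∘ ys)) (map-cartesianProduct f g xs ys))

shuffles-rearrangements : ∀ u w → IsParking (letters u) → All (1 ≤_) (letters w) →
  concatMap (λ v → concatMap (shiftedShuffles v) (rearrangements w)) (rearrangements u) ↭ rearrangements (u •ᶜ w)
shuffles-rearrangements u w pu w>0 = Unique-↭
  (Unique-concatMap (All.tabulate inner-unique)
    (retraction⇒Disjoint (filter (letter≤? k)) (rearrangements-unique u) outer))
  (rearrangements-unique (u •ᶜ w)) to from
  where
  k = length u

  ≤k : ∀ {v} → v ↭ u → All (λ l → proj₁ l ≤ k) v
  ≤k p = All-resp-↭ (↭-sym p) (All.map⁻ (subst (λ n → All (_≤ n) (letters u)) (length-map proj₁ u) (IsParking⇒≤length pu)))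

  >k : ∀ {x} → x ↭ w → All (λ l → ¬ proj₁ l ≤ k) (shiftBy k x)
  >k p = shiftBy-> k (All-resp-↭ (↭-map⁺ proj₁ (↭-sym p)) w>0)

  -- The shift in a shifted shuffle depends on the length of its first word; on rearrangements of
  -- `u` it is the constant `k`, so a single threshold serves for all of them.
  shiftedShuffles≡ : ∀ {v} → v ↭ u → ∀ x → shiftedShuffles v x ≡ shuffles v (shiftBy k x)
  shiftedShuffles≡ {v} p x = cong (λ n → shuffles v (shiftBy n x)) (↭-length p)

  halves : ∀ {v x z} → v ↭ u → x ↭ w → z ∈ shiftedShuffles v x →
           filter (letter≤? k) z ≡ v × filter (¬? ∘ letter≤? k) z ≡ shiftBy k x
  halves {v} {x} {z} p q z∈ = shuffles-filter (letter≤? k) (≤k p) (>k q) (subst (z ∈_) (shiftedShuffles≡ p x) z∈)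

  unshift : CWord → CWord
  unshift = map (map₁ (_∸ k))

  unshift-shift : ∀ x → unshift (shiftBy k x) ≡ x
  unshift-shift x = trans (sym (map-∘ x))
    (map-id-local (All.universal (λ (y , c) → cong (_, c) (ℕ.m+n∸m≡n k y)) x))

  inner-unique : ∀ {v} → v ∈ rearrangements u → Unique (concatMap (shiftedShuffles v) (rearrangements w))
  inner-unique {v} v∈ = Unique-concatMap
    (All.tabulate λ {x} x∈ → subst Unique (sym (shiftedShuffles≡ p x))
      (shuffles-unique (letter≤? k) (≤k p) (>k (∈-rearrangements⁻ {w = w} x∈))))
    (retraction⇒Disjoint (unshift ∘ filter (¬? ∘ letter≤? k)) (rearrangements-unique w)
      λ {x} x∈ z∈ → trans (cong unshift (proj₂ (halves p (∈-rearrangements⁻ {w = w} x∈) z∈))) (unshift-shift x))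
    where
    p : v ↭ u
    p = ∈-rearrangements⁻ {w = u} v∈

  outer : ∀ {v z} → v ∈ rearrangements u → z ∈ concatMap (shiftedShuffles v) (rearrangements w) →
          filter (letter≤? k) z ≡ v
  outer {v} v∈ z∈ with ∈-concatMap-elim (shiftedShuffles v) (rearrangements w) z∈
  ... | x , x∈ , z∈x = proj₁ (halves (∈-rearrangements⁻ {w = u} v∈) (∈-rearrangements⁻ {w = w} x∈) z∈x)

  to : ∀ {z} → z ∈ concatMap (λ v → concatMap (shiftedShuffles v) (rearrangements w)) (rearrangements u) →
       z ∈ rearrangements (u •ᶜ w)
  to z∈ with ∈-concatMap-elim _ (rearrangements u) z∈
  ... | v , v∈ , z∈v with ∈-concatMap-elim (shiftedShuffles v) (rearrangements w) z∈v
  ...   | x , x∈ , z∈x = ∈-rearrangements⁺ (↭-trans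
    (All.lookup (shuffles-↭ v (shiftBy k x)) (subst (_ ∈_) (shiftedShuffles≡ p x) z∈x))
    (++⁺ p (↭-map⁺ _ (∈-rearrangements⁻ {w = w} x∈))))
    where
    p : v ↭ u
    p = ∈-rearrangements⁻ {w = u} v∈

  from : ∀ {z} → z ∈ rearrangements (u •ᶜ w) →
         z ∈ concatMap (λ v → concatMap (shiftedShuffles v) (rearrangements w)) (rearrangements u)
  from {z} z∈ with filter-++-↭ (letter≤? k) (≤k ↭-refl) (>k ↭-refl) (∈-rearrangements⁻ {w = u •ᶜ w} z∈)
  ... | p , q with ↭-map-inv (map₁ (k +_)) (↭-sym q)
  ...   | x , eq , r = ∈-concatMap-intro _ (∈-rearrangements⁺ p)
    (∈-concatMap-intro (shiftedShuffles v) (∈-rearrangements⁺ (↭-sym r))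
      (subst (z ∈_) (trans (cong (shuffles v) eq) (sym (shiftedShuffles≡ p x))) (∈-shuffles (letter≤? k) z)))
    where
    v : CWord
    v = filter (letter≤? k) z

π∅ : SignedNDPF
π∅ = fromFactors []

infixr 5 _⊕_
_⊕_ : SignedNDPF → SignedNDPF → SignedNDPF
π ⊕ σ = fromFactors (factors π ++ factors σ)

word-isParking : ∀ π → IsParking (letters (word π))
word-isParking π = coloredConcat-isParking (factors π)

orbit-⋓ : ∀ π σ → concatMap (λ v → concatMap (v ⋓_) (orbit σ)) (orbit π) ↭ orbit (π ⊕ σ)
orbit-⋓ π σ = map-injective-↭ value-injective (↭-trans (↭-reflexive eq)
  (↭-trans (shuffles-rearrangements (word π) (word σ) (word-isParking π) (IsParking⇒positive (word-isParking σ)))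
    (↭-reflexive (sym (trans (value-orbit (π ⊕ σ)) (cong rearrangements (coloredConcat-++ (factors π) (factors σ))))))))
  where
  eq : map value (concatMap (λ v → concatMap (v ⋓_) (orbit σ)) (orbit π)) ≡
       concatMap (λ v → concatMap (shiftedShuffles v) (rearrangements (word σ))) (rearrangements (word π))
  eq = trans
    (map-concatMap-map {f′ = λ v → concatMap (shiftedShuffles v) (rearrangements (word σ))} {g = value}
      (λ v → trans (map-concatMap-map {f′ = shiftedShuffles (value v)} {g = value} (value-⋓ v) (orbit σ))
                     (cong (concatMap (shiftedShuffles (value v))) (value-orbit σ)))
      (orbit π))
    (cong (concatMap _) (value-orbit π))

orbit-unique : ∀ π → Unique (orbit π)
orbit-unique π = Unique.map⁻ {f = value} (subst Unique (sym (value-orbit π)) (rearrangements-unique (word π)))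

word∈orbit : ∀ π → coloredPF π ∈ orbit π
word∈orbit π with ∈-map⁻ value (subst (word π ∈_) (sym (value-orbit π)) (∈-rearrangements⁺ ↭-refl))
... | v , v∈ , eq = subst (_∈ orbit π) (sym (value-injective eq)) v∈

orbits-disjoint : ∀ π σ → coloredPF σ ∈ orbit π → π ≡ σ
orbits-disjoint π σ σ∈ = factors-injective (sym (coloredConcat-↭ (factors σ) (factors π)
  (∈-rearrangements⁻ {w = word π} (subst (word σ ∈_) (value-orbit π) (∈-map⁺ value σ∈)))))

value² : ColoredPF × ColoredPF → CWord × CWord
value² = Product.map value value

value²-injective : ∀ {x y} → value² x ≡ value² y → x ≡ y
value²-injective eq = cong₂ _,_ (value-injective (cong proj₁ eq)) (value-injective (cong proj₂ eq))

parkᶜ² : CWord × CWord → CWord × CWord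
parkᶜ² = Product.map parkᶜ parkᶜ

-- Separates cutting from parkization, so that grouping and symmetry can be settled for
-- `deconcatenations` and then transported by `map parkᶜ²`.
value-cuts : ∀ π → map value² (concatMap cuts (orbit π)) ≡ map parkᶜ² (deconcatenations (word π))
value-cuts π = trans
  (map-concatMap-map {f′ = λ w → map parkᶜ² (splitAts w)} {g = value}
    (λ w → trans (sym (map-∘ (upTo (suc (length (value w)))))) (map-∘ (upTo (suc (length (value w))))))
    (orbit π))
  (trans (cong (concatMap _) (value-orbit π)) (sym (map-concatMap parkᶜ² splitAts (rearrangements (word π)))))

parkSteps-parking : ∀ m {w} → IsParking w → parkSteps m w ≡ w
parkSteps-parking zero        pw = refl
parkSteps-parking (suc m) {w} pw
  with d w ≡ᵇ suc (length w) | ≡ᵇ-reflects (d w) (suc (length w)) | search-spec w (length w) 1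
... | true  | _     | _                = refl
... | false | ofⁿ ≢ | inj₁ (eq , _)    = contradiction (trans eq (ℕ.+-comm _ 1)) ≢
... | false | _     | inj₂ (_ , c , u) = contradiction
  (IsParking⇒#≤ pw (d w) (s≤s⁻¹ (subst (d w <_) (ℕ.+-comm (length w) 1) u))) (ℕ.<⇒≱ c)

parkᶜ-parking : ∀ {w} → IsParking (letters w) → parkᶜ w ≡ w
parkᶜ-parking {w} pw = trans (cong (λ v → zip v (colors w))
    (trans (parkSteps-parking (sum (letters w)) pw) (sym (map-id (letters w)))))
  (trans (zip-map id w) (map-id w))

-- The relabelling of `u` is injective on its letters, so parkization maps the rearrangements of `u`
-- bijectively onto those of its image.
rearrangements-parkᶜ : ∀ u {w} → w ↭ parkᶜ u → map parkᶜ (rearrangements u) ↭ rearrangements w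
rearrangements-parkᶜ u {w} p = ↭-trans
  (rearrangements-map parkᶜ (map₁ (parkLetter u)) u parkᶜ≡map
    (λ x∈ y∈ eq → cong₂ _,_ (injective (∈-map⁺ proj₁ x∈) (∈-map⁺ proj₁ y∈) (cong proj₁ eq)) (cong proj₂ eq)))
  (rearrangements-cong (↭-trans (↭-reflexive (sym (parkᶜ≡map {w = u} ↭-refl))) (↭-sym p)))
  where open IsRelabelling (parkLetter-isRelabelling u)

parkᶜ-signed : ∀ u v {w} → IsParking (letters w) → Signed w → u ++ v ↭ w → ∃ λ α → word α ↭ parkᶜ u
parkᶜ-signed u v pw sw p = signedNDPF (parkᶜ u)
  (parkᶜ-isParking {u} (All.++⁻ˡ (letters u) (subst (All (1 ≤_)) (map-++ proj₁ u v)
    (All-resp-↭ (↭-map⁺ proj₁ (↭-sym p)) (IsParking⇒positive pw)))))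
  (subst Signed (sym (parkᶜ≡map {w = u} ↭-refl))
    (Signed-relabel u (parkLetter-isRelabelling u) (Signed-++ˡ u v (Signed-↭ (↭-sym p) sw))))

orbit² : SignedNDPF × SignedNDPF → List (ColoredPF × ColoredPF)
orbit² (α , β) = cartesianProduct (orbit α) (orbit β)

parkᶜ²-box : ∀ u v {α β} → word α ↭ parkᶜ u → word β ↭ parkᶜ v →
             map parkᶜ² (box (u , v)) ↭ map value² (orbit² (α , β))
parkᶜ²-box u v {α} {β} p q = ↭-trans
  (↭-reflexive (map-cartesianProduct parkᶜ parkᶜ (rearrangements u) (rearrangements v)))
  (↭-trans (cartesianProduct-↭ (rearrangements-parkᶜ u p) (rearrangements-parkᶜ v q))
    (↭-reflexive (sym (trans (map-cartesianProduct value value (orbit α) (orbit β))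
      (cong₂ cartesianProduct (value-orbit α) (value-orbit β))))))

length-parkᶜ : ∀ u → length (parkᶜ u) ≡ length u
length-parkᶜ u = trans (cong length (parkᶜ≡map {w = u} ↭-refl)) (length-map _ u)

boxes-orbits : ∀ {w} → IsParking (letters w) → Signed w → ∀ rs →
  All (λ (u , v) → u ++ v ↭ w × length u < length w) rs → ∃ λ ss →
  All (λ (α , _) → length (word α) < length w) ss × map parkᶜ² (concatMap box rs) ↭ map value² (concatMap orbit² ss)
boxes-orbits pw sw [] [] = [] , [] , ↭-refl
boxes-orbits {w} pw sw ((u , v) ∷ rs) ((p , l) ∷ h)
  -- The second half is treated as the first half of `v ++ u`, which is again a rearrangement of
  -- `w`.
  with parkᶜ-signed u v pw sw p | parkᶜ-signed v u pw sw (↭-trans (++-comm v u) p) | boxes-orbits pw sw rs h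
... | α , pα | β , pβ | ss , ls , q =
  (α , β) ∷ ss , subst (_< length w) (sym (trans (↭-length pα) (length-parkᶜ u))) l ∷ ls ,
  ↭-trans (↭-reflexive (map-++ parkᶜ² (box (u , v)) (concatMap box rs)))
    (↭-trans (++⁺ (parkᶜ²-box u v {α} {β} pα pβ) q)
      (↭-reflexive (sym (map-++ value² (orbit² (α , β)) (concatMap orbit² ss)))))

orbit-cuts : ∀ π → ∃ λ ss → All (λ (α , _) → length (word α) < length (word π)) ss ×
             concatMap cuts (orbit π) ↭ concatMap orbit² ((π , π∅) ∷ ss)
orbit-cuts π =
  let rs , h , p  = deconcatenations-boxes (word π)
      ss , ls , q = boxes-orbits (word-isParking π) (coloredConcat-signed (factors π)) rs h
  in ss , ls , parked-boxes rs ss p q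
  where
  -- A parking function is fixed by parkization, so the box kept apart becomes exactly the pair
  -- `(π , π∅)`.
  self : word π ↭ parkᶜ (word π)
  self = ↭-reflexive (sym (parkᶜ-parking (word-isParking π)))
  parked-boxes : ∀ rs ss → deconcatenations (word π) ↭ concatMap box ((word π , []) ∷ rs) →
    map parkᶜ² (concatMap box rs) ↭ map value² (concatMap orbit² ss) →
    concatMap cuts (orbit π) ↭ concatMap orbit² ((π , π∅) ∷ ss)
  parked-boxes rs ss p q = map-injective-↭ value²-injective (begin
    map value² (concatMap cuts (orbit π))
      ≡⟨ value-cuts π ⟩
    map parkᶜ² (deconcatenations (word π))
      ↭⟨ ↭-map⁺ parkᶜ² p ⟩
    map parkᶜ² (box (word π , []) ++ concatMap box rs)
      ≡⟨ map-++ parkᶜ² (box (word π , [])) (concatMap box rs) ⟩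
    map parkᶜ² (box (word π , [])) ++ map parkᶜ² (concatMap box rs)
      ↭⟨ ++⁺ (parkᶜ²-box (word π) [] {π} {π∅} self ↭-refl) q ⟩
    map value² (orbit² (π , π∅)) ++ map value² (concatMap orbit² ss)
      ≡⟨ map-++ value² (orbit² (π , π∅)) (concatMap orbit² ss) ⟨
    map value² (orbit² (π , π∅) ++ concatMap orbit² ss) ∎)
    where open Perm.PermutationReasoning

deconcatenations-swap : ∀ w → map swap (deconcatenations w) ↭ deconcatenations w
deconcatenations-swap w = Unique-↭
  (Unique.map⁺ (cong swap) (deconcatenations-unique w)) (deconcatenations-unique w) to from
  where
  to : ∀ {s} → s ∈ map swap (deconcatenations w) → s ∈ deconcatenations w
  to s∈ with ∈-map⁻ swap s∈
  ... | (u , v) , uv∈ , refl = ∈-deconcatenations⁺ v u (↭-trans (++-comm v u) (∈-deconcatenations⁻ w uv∈))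
  from : ∀ {s} → s ∈ deconcatenations w → s ∈ map swap (deconcatenations w)
  from {u , v} s∈ = ∈-map⁺ swap (∈-deconcatenations⁺ v u (↭-trans (++-comm v u) (∈-deconcatenations⁻ w s∈)))

orbit-cuts-swap : ∀ π → map swap (concatMap cuts (orbit π)) ↭ concatMap cuts (orbit π)
orbit-cuts-swap π = map-injective-↭ value²-injective (↭-trans (↭-reflexive eq)
  (↭-trans (↭-map⁺ parkᶜ² (deconcatenations-swap (word π))) (↭-reflexive (sym (value-cuts π)))))
  where
  C = concatMap cuts (orbit π)
  D = deconcatenations (word π)
  open ≡.≡-Reasoning
  eq : map value² (map swap C) ≡ map parkᶜ² (map swap D)
  eq = begin
    map value² (map swap C)        ≡⟨ trans (sym (map-∘ C)) (map-∘ C) ⟩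
    map swap (map value² C)        ≡⟨ cong (map swap) (value-cuts π) ⟩
    map swap (map parkᶜ² D)        ≡⟨ trans (sym (map-∘ D)) (map-∘ D) ⟩
    map parkᶜ² (map swap D)        ∎

⋓-identityʳ : ∀ v → v ⋓ ∅ ≡ v ∷ []
⋓-identityʳ v = map-injective value-injective (trans (value-⋓ v ∅) (shuffles-[]ʳ (value v)))

-- Hopf subalgebras spanned by a family closed under the operations

module SpanOfSubBialgebra {c ℓ} (K : CommutativeRing c ℓ) where

  open FreeModule K
  open Linear K

  module _ {i b} {I : Set i} {B : Set b}
    ⦃ _ : IsDecEquivalence {A = I} _≡_ ⦄ ⦃ _ : IsDecEquivalence {A = B} _≡_ ⦄
    (H : StructureMaps B) where

    open StructureMaps H

    -- In `v-Δ` the term `v i ⊗ v ε` stands alone and every other first factor has smaller degree.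
    -- Convolving with an antipode then gives an equation whose only new unknown is the antipode of
    -- `v i`.
    module _
      (v : I → Lin B) (ε : I) (_⊕_ : I → I → I) (degree : I → ℕ)
      (v-ε : v ε ≐ unit)
      (v-∙ : ∀ i j → v i ∙ v j ≐ v (i ⊕ j))
      (v-Δ : ∀ i → ∃ λ (ss : List (I × I)) → All (λ (j , _) → degree j < degree i) ss ×
             Δ (v i) ≐ concatMap {A = I × I} (λ (j , k) → v j ⊗ v k) ((i , ε) ∷ ss))
      (v-twist : ∀ i → twist (Δ (v i)) ≐ Δ (v i))
      (∙-identityʳ : ∀ x → x ∙ unit ≐ x) where

      private
        V : Lin B → Set _
        V = Span v

        V-sub : IsSubmodule V
        V-sub = Span-isSubmodule v

        open IsSubmodule V-sub

        v∈V : ∀ i → V (v i)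
        v∈V = Span-member v

        unit∈V : V unit
        unit∈V = ≐-closed v-ε (v∈V ε)

        swapped : B × B → Lin (B × B)
        swapped (a , b) = basis (b , a)

        v⊗v : I × I → Lin (B × B)
        v⊗v (j , k) = v j ⊗ v k

      cocommutative : IsCocommutativeOn H V
      cocommutative {x} (k , e) = ≐⇒≋ (begin
        twist (Δ x)                                   ≈⟨ linear-linear swapped coproduct x ⟩
        linear (twist ∘ coproduct) x                  ≈⟨ linear-congʳ (twist ∘ coproduct) x≐ ⟩
        linear (twist ∘ coproduct) (linear v k)       ≈⟨ linear-linear (twist ∘ coproduct) v k ⟩
        linear (linear (twist ∘ coproduct) ∘ v) k     ≈⟨ linear-congˡ twisted k ⟩
        linear (Δ ∘ v) k                              ≈⟨ linear-linear coproduct v k ⟨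
        Δ (linear v k)                                ≈⟨ linear-congʳ coproduct x≐ ⟨
        Δ x                                           ∎)
        where
        open ≐-Reasoning
        x≐ : x ≐ linear v k
        x≐ = ≋⇒≐ x (linear v k) e
        twisted : ∀ i → linear (twist ∘ coproduct) (v i) ≐ Δ (v i)
        twisted i = ≐.trans (≐.sym (linear-linear swapped coproduct (v i))) (v-twist i)

      -- `Span-linear` handles one argument at a time; `linear-swap` exchanges the two summations to
      -- bring the second argument outside.
      ∙-closed : ∀ {x y} → V x → V y → V (x ∙ y)
      ∙-closed {x} {y} x∈V y∈V = Span-linear v V-sub {λ a → linear (product a) y} left {x} x∈V
        where
        left : ∀ i → V (v i ∙ y)
        left i = ≐-closed (≐.sym (linear-swap product (v i) y))
          (Span-linear v V-sub {λ b → linear (λ a → product a b) (v i)}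
            (λ j → ≐-closed (≐.trans (≐.sym (v-∙ i j)) (linear-swap product (v i) (v j))) (v∈V (i ⊕ j)))
            {y} y∈V)

      Δ-closed : ∀ {x} → V x → TensorSquare H V (Δ x)
      Δ-closed {x} = Span-linear v (TensorSquare-isSubmodule H V-sub) {coproduct} Δv {x}
        where
        Δv : ∀ i → TensorSquare H V (Δ (v i))
        Δv i = let ss , _ , e = v-Δ i in
          map (Product.map v v) ((i , ε) ∷ ss) ,
          All.map⁺ (All.universal (λ (j , k) → v∈V j , v∈V k) ((i , ε) ∷ ss)) ,
          ≐⇒≋ (≐.trans e (≐.reflexive (sym (concatMap-map (uncurry _⊗_) (Product.map v v) ((i , ε) ∷ ss)))))

      module _ {S : B → Lin B} (antipode : IsAntipode H S) where

        open IsAntipode antipode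

        private
          S∗id : B × B → Lin B
          S∗id (a , b) = S a ∙ basis b

        S∗id-⊗ : ∀ x y → linear S∗id (x ⊗ y) ≐ linear S x ∙ y
        S∗id-⊗ x y = begin
          linear S∗id (x ⊗ y)                                             ≈⟨ linear-linear S∗id (λ a → linear (λ b → basis (a , b)) y) x ⟩
          linear (λ a → linear S∗id (linear (λ b → basis (a , b)) y)) x   ≈⟨ linear-congˡ inner x ⟩
          linear (λ a → S a ∙ y) x                                        ≈⟨ linear-linear (λ a → linear (product a) y) S x ⟨
          linear S x ∙ y                                                  ∎
          where
          open ≐-Reasoning
          evaluate : ∀ a b → S a ∙ basis b ≐ linear (λ a′ → product a′ b) (S a)
          evaluate a b = linear-congˡ (λ a′ → linear-basis (product a′) b) (S a)
          inner : ∀ a → linear S∗id (linear (λ b → basis (a , b)) y) ≐ S a ∙ y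
          inner a = begin
            linear S∗id (linear (λ b → basis (a , b)) y)               ≈⟨ linear-linear S∗id (λ b → basis (a , b)) y ⟩
            linear (λ b → linear S∗id (basis (a , b))) y               ≈⟨ linear-congˡ (λ b → linear-basis S∗id (a , b)) y ⟩
            linear (λ b → S a ∙ basis b) y                             ≈⟨ linear-congˡ (evaluate a) y ⟩
            linear (λ b → linear (λ a′ → product a′ b) (S a)) y        ≈⟨ linear-swap product (S a) y ⟨
            S a ∙ y                                                    ∎

        -- By the left inverse law each basis element contributes a multiple of the unit, which lies
        -- in the span.
        S∗id-Δ-closed : ∀ x → V (linear S∗id (Δ x))
        S∗id-Δ-closed x = ≐-closed
          (≐.sym (≐.trans (linear-linear S∗id coproduct x)
            (linear-congˡ (λ b → ≋⇒≐ (linear S∗id (coproduct b)) (counit b · unit) (inverseˡ b)) x)))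
          (linear-closed {f = λ b → counit b · unit} (λ b → ·-closed (counit b) {unit} unit∈V) x)

        -- Solve (S ∗ id)(v i) = ε(v i) 1 for S (v i), by induction on the degree.
        S-closed-v : ∀ n i → degree i < n → V (linear S (v i))
        S-closed-v (suc n) i i<n with v-Δ i
        ... | ss , shorter , e = ≐-closed
          (≐.trans (S∗id-⊗ (v i) (v ε))
            (≐.trans (linear-congˡ (λ a → linear-congʳ (product a) v-ε) (linear S (v i))) (∙-identityʳ (linear S (v i)))))
          (cancelʳ-closed {linear S∗id (v i ⊗ v ε)} {concatMap (linear S∗id ∘ v⊗v) ss}
            (≐-closed (≐.trans (linear-congʳ S∗id e) (linear-concatMap S∗id v⊗v ((i , ε) ∷ ss)))
              (S∗id-Δ-closed (v i)))
            (concatMap-closed {f = linear S∗id ∘ v⊗v} (All.map (λ {(j , k)} j<i → ≐-closed (≐.sym (S∗id-⊗ (v j) (v k)))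
              (∙-closed {linear S (v j)} {v k} (S-closed-v n j (≤-trans j<i (s≤s⁻¹ i<n))) (v∈V k))) shorter)))

        S-closed : ∀ {x} → V x → V (linear S x)
        S-closed {x} = Span-linear v V-sub {S} (λ i → S-closed-v (suc (degree i)) i ≤-refl) {x}

      isHopfSubalgebra : IsHopfSubalgebra H V
      isHopfSubalgebra = record
        { ≋-closed = λ {x} {y} e → ≐-closed (≋⇒≐ x y e)
        ; 0-closed = 0-closed
        ; +-closed = λ {x} {y} → +-closed {x} {y}
        ; ·-closed = λ k {x} → ·-closed k {x}
        ; 1-closed = unit∈V
        ; ∙-closed = λ {x} {y} → ∙-closed {x} {y}
        ; Δ-closed = λ {x} → Δ-closed {x}
        ; S-closed = λ antipode {x} → S-closed antipode {x}
        }

-- The identities between orbits, read as identities between the `P π`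

module _ {c ℓ} (K : CommutativeRing c ℓ) where

  open CommutativeRing K using (_≈_) renaming (sym to ≈-sym; trans to ≈-trans)
  open FreeModule K
  open Linear K
  open SpanOfSubBialgebra K
  open StructureMaps (PQSym² K)

  P-∙ : ∀ π σ → P K π ∙ P K σ ≐ P K (π ⊕ σ)
  P-∙ π σ = ≐.trans
    (linear-∑ {g = λ v → concatMap (v ⋓_) (orbit σ)} (λ v → linear-∑ {g = v ⋓_} (λ w → ≐.refl) (orbit σ)) (orbit π))
    (∑-↭ (orbit-⋓ π σ))

  Δ-∑ : ∀ xs → Δ (∑ xs) ≐ ∑ (concatMap cuts xs)
  Δ-∑ = linear-∑ {g = cuts} (λ w → ≐.refl)

  ∑-orbit² : ∀ ss → ∑ (concatMap orbit² ss) ≐ concatMap (λ (α , β) → P K α ⊗ P K β) ss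
  ∑-orbit² ss = ≐.trans (≐.reflexive (map-concatMap _ orbit² ss))
    (concatMap-≐ (λ (α , β) → ≐.sym (∑-⊗-∑ (orbit α) (orbit β))) ss)

  Δ-P-boxes : ∀ π ts → concatMap cuts (orbit π) ↭ concatMap orbit² ts →
        Δ (P K π) ≐ concatMap (λ (α , β) → P K α ⊗ P K β) ts
  Δ-P-boxes π ts e = ≐.trans (Δ-∑ (orbit π)) (≐.trans (∑-↭ e) (∑-orbit² ts))

  P-Δ : ∀ π → ∃ λ ss → All (λ (α , _) → length (word α) < length (word π)) ss ×
        Δ (P K π) ≐ concatMap (λ (α , β) → P K α ⊗ P K β) ((π , π∅) ∷ ss)
  P-Δ π = let ss , shorter , e = orbit-cuts π in ss , shorter , Δ-P-boxes π ((π , π∅) ∷ ss) e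

  twist-∑ : ∀ {a b} {A : Set a} {B : Set b} (xs : List (A × B)) → twist (∑ xs) ≐ ∑ (map swap xs)
  twist-∑ []       = ≐.refl
  twist-∑ (x ∷ xs) = ++-cong (1·x≐x _) (twist-∑ xs)

  P-twist : ∀ π → twist (Δ (P K π)) ≐ Δ (P K π)
  P-twist π = begin
    twist (Δ (P K π))                                   ≈⟨ linear-congʳ (λ (v , w) → basis (w , v)) (Δ-∑ (orbit π)) ⟩
    twist (∑ (concatMap cuts (orbit π)))                ≈⟨ twist-∑ (concatMap cuts (orbit π)) ⟩
    ∑ (map swap (concatMap cuts (orbit π)))     ≈⟨ ∑-↭ (orbit-cuts-swap π) ⟩
    ∑ (concatMap cuts (orbit π))                        ≈⟨ Δ-∑ (orbit π) ⟨
    Δ (P K π)                                           ∎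
    where open ≐-Reasoning

  ∙-identityʳ : ∀ x → x ∙ unit ≐ x
  ∙-identityʳ x = ≐.trans
    (linear-congˡ (λ v → ≐.trans (linear-basis (product v) ∅) (≐.reflexive (cong ∑ (⋓-identityʳ v)))) x)
    (linear-basis-id x)

  -- Each orbit contains its own word exactly once and the word of no other index, so these words
  -- provide the dual system for `independent`.
  coeff-P : ∀ π σ → coeff (P K π) (coloredPF σ) ≈ δ σ π
  coeff-P π σ = go (π ≟ σ)
    where
    go : Dec (π ≡ σ) → coeff (P K π) (coloredPF σ) ≈ δ σ π
    go (yes refl) = ≈-trans (coeff-∑-∈ (orbit-unique π) (word∈orbit π)) (≈-sym (δ-refl π))
    go (no π≢σ)     = ≈-trans
      (coeff-∑-∉ (All.tabulate λ { v∈ refl → π≢σ (orbits-disjoint π σ v∈) })) (≈-sym (δ-≢ π≢σ))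

  P-isBasis : IsBasisOf (P K) (NCPQSym² K)
  P-isBasis = record
    { member      = Span-member (P K)
    ; independent = independent (P K) coloredPF coeff-P
    ; spanning    = λ x x∈V → x∈V
    }

  NCPQSym²-isHopfSubalgebra : IsHopfSubalgebra (PQSym² K) (NCPQSym² K)
  NCPQSym²-isHopfSubalgebra =
    isHopfSubalgebra (PQSym² K) (P K) π∅ _⊕_ (length ∘ word) ≐.refl P-∙ P-Δ P-twist ∙-identityʳ

  NCPQSym²-cocommutative : IsCocommutativeOn (PQSym² K) (NCPQSym² K)
  NCPQSym²-cocommutative {x} =
    cocommutative (PQSym² K) (P K) π∅ _⊕_ (length ∘ word) ≐.refl P-∙ P-Δ P-twist ∙-identityʳ {x}

theorem8p2 : ∀ {c ℓ} (K : CommutativeRing c ℓ) → let open FreeModule K in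
    IsBasisOf (P K) (NCPQSym² K) ×
    IsHopfSubalgebra (PQSym² K) (NCPQSym² K) ×
    IsCocommutativeOn (PQSym² K) (NCPQSym² K)
theorem8p2 K = P-isBasis K , NCPQSym²-isHopfSubalgebra K , λ {x} → NCPQSym²-cocommutative K {x}
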